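{- For every $\epsilon>0$ there exists $m_0$ such that for all integers $n$ and $m$ with $m\geq m_0$ and $m>n\geq 2$, we have $R(K_{1,m}, W_{2n})\leq (2+\epsilon)m+n$.
   Context: For $k\ge 3$, the wheel $W_k$ is the graph on $k+1$ vertices obtained by joining one vertex to every vertex of a cycle of length $k$; also $W_4$ etc. follow this definition, and $W_2=K_3$. $K_{1,m}$ is the star with $m$ leaves. For graphs $H_1,H_2$, the Ramsey number $R(H_1,H_2)$ is the smallest integer $N$ such that in every coloring of the edges of $K_N$ with colors 1 and 2 there is a copy of $H_1$ in color 1 or a copy of $H_2$ in color 2. -}

module Defs where

open import Data.Nat using (ℕ; suc; _+_; _*_)
open import Data.Fin using (Fin; zero; suc; toℕ)
open import Data.Bool using (Bool; true; false)
open import Data.Product using (Σ; ∃; _×_; _,_)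
open import Data.Sum using (_⊎_)
open import Relation.Binary.PropositionalEquality using (_≡_)
open import Function.Definitions using (Injective)
open import Level using (0ℓ)

record Graph : Set₁ where
  field
    size : ℕ
    Adj  : Fin size → Fin size → Set

open Graph public

-- A red/blue colouring of the edges of K_N: a symmetric colouring of pairs.
-- Colour 1 = true, colour 2 = false.  (Diagonal values are irrelevant.)
Colouring : ℕ → Set
Colouring N = Σ (Fin N → Fin N → Bool) λ c → ∀ i j → c i j ≡ c j i

HasCopy : ∀ {N} → Colouring N → Bool → Graph → Set
HasCopy {N} (c , _) b H =
  Σ (Fin (size H) → Fin N) λ f →
    Injective _≡_ _≡_ f × (∀ u v → Adj H u v → c (f u) (f v) ≡ b)

Arrows : ℕ → Graph → Graph → Set
Arrows N H₁ H₂ = (c : Colouring N) → HasCopy c true H₁ ⊎ HasCopy c false H₂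

data StarAdj {m : ℕ} : Fin (suc m) → Fin (suc m) → Set where
  centre-leaf : (i : Fin m) → StarAdj zero (suc i)
  leaf-centre : (i : Fin m) → StarAdj (suc i) zero

Star : ℕ → Graph
Star m = record { size = suc m ; Adj = StarAdj {m} }

Next : (k : ℕ) → Fin k → Fin k → Set
Next k i j = (toℕ j ≡ suc (toℕ i)) ⊎ (suc (toℕ i) ≡ k × toℕ j ≡ 0)

data WheelAdj {k : ℕ} : Fin (suc k) → Fin (suc k) → Set where
  hub-rim  : (i : Fin k) → WheelAdj zero (suc i)
  rim-hub  : (i : Fin k) → WheelAdj (suc i) zero
  rim-next : (i j : Fin k) → Next k i j → WheelAdj (suc i) (suc j)
  rim-prev : (i j : Fin k) → Next k j i → WheelAdj (suc i) (suc j)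

Wheel : ℕ → Graph
Wheel k = record { size = suc k ; Adj = WheelAdj {k} }

-- R(H₁,H₂) ≤ x  (x a rational bound): some N ≤ x arrows (H₁,H₂);
-- since R is the least such N, this is exactly "R(H₁,H₂) ≤ x".

{-# OPTIONS --safe #-}

-- Take N = 2m + n + e vertices with e = ⌊m/d⌋ for a denominator d of ε, and suppose that no vertex has m
-- red neighbours. Then every vertex has at most m blue non-neighbours, itself included. Let A be the blue
-- neighbourhood of a vertex v₀, so that |A| ≥ m + n + e and A has minimum blue degree at least n + e.
--
-- If A has a cut X, Y with at most e boundary vertices, say |X| ≤ |Y|, take a hub x in X. As Y consists of
-- non-neighbours of all of X, at least n neighbours of x lie in X, and any two of them have 2n common
-- neighbours inside the neighbourhood of x; alternating between the two kinds of vertices gives a 2n-cycle.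
--
-- Otherwise A expands, so any two of its vertices are joined by a path of bounded length that avoids a given
-- bounded set. By averaging, A contains a complete bipartite graph of large constant size, and bounded
-- lists of vertices that meet the neighbourhoods of all but e/4 vertices. Small n is settled by the
-- bipartite graph alone. For large n, an argument of Dirac gives a path with 2n − O(1) edges that avoids a
-- bounded reserved set; its ends are led through the two lists into that set. There an
-- edge inside a layer of a breadth-first search (if there is none, all closed walks are even) corrects the
-- parity of the closed walk, and a zigzag through the bipartite graph corrects its length.

module Submission where

open import Defs
open import Data.Nat
  using (ℕ; zero; suc; _≥_; _>_; _≤_; z≤n; s≤s; s≤s⁻¹; z<s; parity; NonZero; _≤?_; >-nonZero; _^_)
open import Data.Nat as ℕ using () renaming (_+_ to _+ℕ_; _*_ to _*ℕ_; _<_ to _<ℕ_; _/_ to _/ℕ_)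
import Data.Nat.Properties as ℕₚ
import Data.Nat.DivMod as DM
open import Data.Nat.Coprimality using (Coprime)
open import Data.Nat.Tactic.RingSolver using (solve-∀; solve)
open import Data.Integer as ℤ using (+_)
import Data.Integer.Properties as ℤₚ
open import Data.Rational using (ℚ; 0ℚ; _<_; _+_; _*_; _/_)
import Data.Rational as ℚ
import Data.Rational.Properties as ℚₚ
import Data.Rational.Unnormalised as ℚᵘ
import Data.Rational.Unnormalised.Properties as ℚᵘₚ
open import Data.Parity using (0ℙ; 1ℙ)
open import Data.Bool using (true; false)
import Data.Bool.Properties as 𝔹ₚ
open import Data.Fin using (Fin; zero; suc; toℕ; fromℕ<)
import Data.Fin.Properties as Fₚ
import Data.Fin.Subset as Sub
import Data.Fin.Subset.Properties as Subₚ
import Data.Vec as Vec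
import Data.Vec.Properties as Vecₚ
open import Data.List using (List; []; _∷_; _++_; length; filter; lookup; [_]; _∷ʳ_; take)
import Data.List.Properties as Lₚ
open import Data.List.Membership.Propositional using (_∈_; _∉_)
open import Data.List.Membership.Propositional.Properties
  using (∈-filter⁺; ∈-filter⁻; ∈-++⁺ˡ; ∈-++⁺ʳ; ∈-++⁻; ∈-lookup)
open import Data.List.Relation.Unary.Any using (here; there)
open import Data.List.Relation.Unary.All using (All; []; _∷_)
import Data.List.Relation.Unary.All as All
import Data.List.Relation.Unary.All.Properties as Allₚ
open import Data.List.Relation.Unary.AllPairs using ([]; _∷_)
open import Data.List.Relation.Unary.Unique.Propositional using (Unique)
import Data.List.Relation.Unary.Unique.Propositional.Properties as Uₚ
open import Data.Product using (Σ; _×_; _,_; proj₁; proj₂; ∃-syntax)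
open import Data.Sum using (_⊎_; inj₁; inj₂; [_,_]′)
open import Data.Empty using (⊥; ⊥-elim)
open import Function using (_∘_; id)
open import Relation.Nullary using (¬_; Dec; yes; no; does; contradiction)
open import Relation.Nullary.Decidable using (_×-dec_; _⊎-dec_; ¬?; _→-dec_; decidable-stable; dec-true)
open import Relation.Binary.Definitions using (tri<; tri≈; tri>)
open import Relation.Binary.PropositionalEquality hiding ([_])
open import Algebra.Properties.CommutativeMonoid.Sum ℕₚ.+-0-commutativeMonoid
  using (sum; ∑-distrib-+; ∑-comm)

-- Unambiguous names for the list constructors in the variable lists of the ring solver.
infixr 5 _◂_
pattern _◂_ x xs = Data.List._∷_ x xs
pattern ∎ₗ = Data.List.[]

-- With L ≤ R a sum of hypotheses and s the slack, a linear inequality becomes a semiring identity.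
opaque
  linear : ∀ {a b L R} s → L ≤ R → a +ℕ R +ℕ s ≡ b +ℕ L → a ≤ b
  linear {a} {b} {L} {R} s L≤R eq = ℕₚ.+-cancelʳ-≤ R a b (begin
    a +ℕ R       ≤⟨ ℕₚ.m≤m+n _ s ⟩
    a +ℕ R +ℕ s  ≡⟨ eq ⟩
    b +ℕ L       ≤⟨ ℕₚ.+-monoʳ-≤ b L≤R ⟩
    b +ℕ R       ∎)
    where open ℕₚ.≤-Reasoning

-- Sums over vertices and sizes of vertex sets

sum-mono : ∀ {N} {f g : Fin N → ℕ} → (∀ v → f v ≤ g v) → sum f ≤ sum g
sum-mono {zero}  f≤g = z≤n
sum-mono {suc N} f≤g = ℕₚ.+-mono-≤ (f≤g zero) (sum-mono (f≤g ∘ suc))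

sum-const : ∀ N k → sum {N} (λ _ → k) ≡ N *ℕ k
sum-const zero    k = refl
sum-const (suc N) k = cong (k +ℕ_) (sum-const N k)

sum-*ʳ : ∀ {N} (f : Fin N → ℕ) k → sum (λ v → f v *ℕ k) ≡ sum f *ℕ k
sum-*ʳ {zero}  f k = refl
sum-*ʳ {suc N} f k = trans (cong (f zero *ℕ k +ℕ_) (sum-*ʳ (f ∘ suc) k))
                           (sym (ℕₚ.*-distribʳ-+ k (f zero) _))

indicator : ∀ {P : Set} → Dec P → ℕ
indicator (yes _) = 1
indicator (no _)  = 0

indicator-no : ∀ {P : Set} → ¬ P → (P? : Dec P) → indicator P? ≡ 0
indicator-no ¬p (yes p) = contradiction p ¬p
indicator-no ¬p (no _)  = refl

record DSet (N : ℕ) : Set₁ where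
  constructor dset
  field
    mem  : Fin N → Set
    mem? : ∀ v → Dec (mem v)

open DSet

χ : ∀ {N} → DSet N → Fin N → ℕ
χ X v = indicator (mem? X v)

opaque
  card : ∀ {N} → DSet N → ℕ
  card X = sum (χ X)

_⊆_ : ∀ {N} → DSet N → DSet N → Set
X ⊆ Y = ∀ v → mem X v → mem Y v

infixl 7 _∩_
infixl 6 _∪_ _∖_

_∩_ _∪_ _∖_ : ∀ {N} → DSet N → DSet N → DSet N
X ∩ Y = dset (λ v → mem X v × mem Y v) (λ v → mem? X v ×-dec mem? Y v)
X ∪ Y = dset (λ v → mem X v ⊎ mem Y v) (λ v → mem? X v ⊎-dec mem? Y v)
X ∖ Y = dset (λ v → mem X v × ¬ mem Y v) (λ v → mem? X v ×-dec ¬? (mem? Y v))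

full : ∀ {N} → DSet N
full = dset (λ v → v ≡ v) (λ v → yes refl)

module _ {N : ℕ} where

  open import Data.List.Membership.DecPropositional (Fₚ._≟_ {N}) public using (_∈?_)

⟪_⟫ : ∀ {N} → List (Fin N) → DSet N
⟪ l ⟫ = dset (_∈ l) (_∈? l)

opaque
  unfolding card

  card-cover : ∀ {N} (X Y Z : DSet N) → (∀ v → mem X v → mem Y v ⊎ mem Z v) → card X ≤ card Y +ℕ card Z
  card-cover {N} X Y Z cov = subst (card X ≤_) (∑-distrib-+ {N} (χ Y) (χ Z)) (sum-mono pointwise)
    where
    pointwise : ∀ v → indicator (mem? X v) ≤ indicator (mem? Y v) +ℕ indicator (mem? Z v)
    pointwise v with mem? X v | mem? Y v | mem? Z v
    ... | no _  | _     | _     = z≤n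
    ... | yes _ | yes _ | _     = s≤s z≤n
    ... | yes _ | no _  | yes _ = s≤s z≤n
    ... | yes x | no ¬y | no ¬z = [ ⊥-elim ∘ ¬y , ⊥-elim ∘ ¬z ]′ (cov v x)

  card-disjoint : ∀ {N} (X Y Z : DSet N) → Y ⊆ X → Z ⊆ X → (∀ v → mem Y v → ¬ mem Z v) →
                  card Y +ℕ card Z ≤ card X
  card-disjoint {N} X Y Z Y⊆X Z⊆X dis = subst (_≤ card X) (∑-distrib-+ {N} (χ Y) (χ Z)) (sum-mono pointwise)
    where
    pointwise : ∀ v → indicator (mem? Y v) +ℕ indicator (mem? Z v) ≤ indicator (mem? X v)
    pointwise v with mem? X v | mem? Y v | mem? Z v
    ... | _     | no _  | no _  = z≤n
    ... | yes _ | yes _ | no _  = s≤s z≤n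
    ... | yes _ | no _  | yes _ = s≤s z≤n
    ... | _     | yes y | yes z = ⊥-elim (dis v y z)
    ... | no ¬x | yes y | no _  = ⊥-elim (¬x (Y⊆X v y))
    ... | no ¬x | no _  | yes z = ⊥-elim (¬x (Z⊆X v z))

  card-mono : ∀ {N} (X Y : DSet N) → X ⊆ Y → card X ≤ card Y
  card-mono {N} X Y X⊆Y = sum-mono pointwise
    where
    pointwise : ∀ v → indicator (mem? X v) ≤ indicator (mem? Y v)
    pointwise v with mem? X v | mem? Y v
    ... | no _  | _     = z≤n
    ... | yes _ | yes _ = s≤s z≤n
    ... | yes x | no ¬y = ⊥-elim (¬y (X⊆Y v x))

  card-empty : ∀ {N} (X : DSet N) → (∀ v → ¬ mem X v) → card X ≤ 0
  card-empty {N} X none = subst (card X ≤_) (trans (sum-const N 0) (ℕₚ.*-zeroʳ N))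
    (sum-mono (λ v → ℕₚ.≤-reflexive (indicator-no (none v) (mem? X v))))

  card-full : ∀ {N} → card {N} full ≡ N
  card-full {N} = trans (sum-const N 1) (ℕₚ.*-identityʳ N)

  card-≤ : ∀ {N} (X : DSet N) → card X ≤ N
  card-≤ {N} X = subst (card X ≤_) card-full (card-mono X full (λ _ _ → refl))

  card-singleton : ∀ {N} (a : Fin N) → card ⟪ [ a ] ⟫ ≡ 1
  card-singleton {suc N} zero    = cong (1 +ℕ_)
    (ℕₚ.≤-antisym (card-empty {N} (dset (λ v → suc v ∈ [ zero ]) (λ v → suc v ∈? [ zero ]))
                              (λ { v (here ()) ; v (there ()) })) z≤n)
  card-singleton {suc N} (suc a) = trans {j = card ⟪ [ a ] ⟫}
    (ℕₚ.≤-antisym (card-mono {N} (dset (λ v → suc v ∈ [ suc a ]) (λ v → suc v ∈? [ suc a ])) ⟪ [ a ] ⟫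
                             (λ { v (here refl) → here refl }))
                  (card-mono ⟪ [ a ] ⟫ (dset (λ v → suc v ∈ [ suc a ]) (λ v → suc v ∈? [ suc a ]))
                             (λ { v (here refl) → here refl })))
    (card-singleton a)

module _ {N : ℕ} where

  card-≤-length : (X : DSet N) (l : List (Fin N)) → (∀ v → mem X v → v ∈ l) → card X ≤ length l
  card-≤-length X []      sub = card-empty X λ v x → case-[] (sub v x)
    where
    case-[] : ∀ {v : Fin N} → ¬ (v ∈ [])
    case-[] ()
  card-≤-length X (a ∷ l) sub = begin
    card X                                  ≤⟨ card-cover X ⟪ [ a ] ⟫ (X ∖ ⟪ [ a ] ⟫) split ⟩
    card ⟪ [ a ] ⟫ +ℕ card (X ∖ ⟪ [ a ] ⟫)  ≡⟨ cong (_+ℕ card (X ∖ ⟪ [ a ] ⟫)) (card-singleton a) ⟩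
    suc (card (X ∖ ⟪ [ a ] ⟫))              ≤⟨ s≤s (card-≤-length (X ∖ ⟪ [ a ] ⟫) l rest) ⟩
    suc (length l)                          ∎
    where
    open ℕₚ.≤-Reasoning
    split : ∀ v → mem X v → v ∈ [ a ] ⊎ (mem X v × v ∉ [ a ])
    split v x with v ∈? [ a ]
    ... | yes p = inj₁ p
    ... | no ¬p = inj₂ (x , ¬p)
    rest : ∀ v → mem X v × v ∉ [ a ] → v ∈ l
    rest v (x , ≢a) with sub v x
    ... | here refl = ⊥-elim (≢a (here refl))
    ... | there p   = p

  length-≤-card : (X : DSet N) (l : List (Fin N)) → Unique l → (∀ {v} → v ∈ l → mem X v) → length l ≤ card X
  length-≤-card X []      _         _   = z≤n
  length-≤-card X (a ∷ l) (a∉ ∷ ul) sub = begin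
    suc (length l)                          ≤⟨ s≤s (length-≤-card (X ∖ ⟪ [ a ] ⟫) l ul rest) ⟩
    suc (card (X ∖ ⟪ [ a ] ⟫))              ≡⟨ cong (_+ℕ card (X ∖ ⟪ [ a ] ⟫)) (card-singleton a) ⟨
    card ⟪ [ a ] ⟫ +ℕ card (X ∖ ⟪ [ a ] ⟫)
      ≤⟨ card-disjoint X ⟪ [ a ] ⟫ (X ∖ ⟪ [ a ] ⟫) (λ { v (here refl) → sub (here refl) }) (λ _ → proj₁)
            (λ v p q → proj₂ q p) ⟩
    card X                                  ∎
    where
    open ℕₚ.≤-Reasoning
    rest : ∀ {v} → v ∈ l → mem X v × v ∉ [ a ]
    rest p = sub (there p) , λ { (here refl) → All.lookup a∉ p refl }

  pick : (X : DSet N) (l : List (Fin N)) → length l <ℕ card X → ∃[ v ] mem X v × v ∉ l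
  pick X l lt with Fₚ.any? (λ v → mem? X v ×-dec ¬? (v ∈? l))
  ... | yes p = p
  ... | no ¬p = contradiction (card-≤-length X l sub) (ℕₚ.<⇒≱ lt)
    where
    sub : ∀ v → mem X v → v ∈ l
    sub v x = decidable-stable (v ∈? l) λ v∉ → ¬p (v , x , v∉)

  pick-list : (X : DSet N) (D : List (Fin N)) (t : ℕ) → t +ℕ length D ≤ card X →
              ∃[ l ] Unique l × length l ≡ t × (∀ {v} → v ∈ l → mem X v × v ∉ D)
  pick-list X D zero    _ = [] , [] , refl , λ ()
  pick-list X D (suc t) h with pick-list X D t (ℕₚ.≤-trans (ℕₚ.n≤1+n _) h)
  ... | l , ul , refl , sub with pick X (l ++ D) (subst (_<ℕ card X) (sym (Lₚ.length-++ l)) h)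
  ... | v , x , v∉ = v ∷ l , Allₚ.¬Any⇒All¬ l (v∉ ∘ ∈-++⁺ˡ) ∷ ul , refl ,
        λ { (here refl) → x , v∉ ∘ ∈-++⁺ʳ l ; (there p) → sub p }

  card-∖-list : (X : DSet N) (l : List (Fin N)) → card X ≤ card (X ∖ ⟪ l ⟫) +ℕ length l
  card-∖-list X l = ℕₚ.≤-trans (card-cover X (X ∖ ⟪ l ⟫) ⟪ l ⟫ split)
                              (ℕₚ.+-monoʳ-≤ _ (card-≤-length ⟪ l ⟫ l (λ _ → id)))
    where
    split : ∀ v → mem X v → (mem X v × v ∉ l) ⊎ v ∈ l
    split v x with v ∈? l
    ... | yes p = inj₂ p
    ... | no ¬p = inj₁ (x , ¬p)

-- Paths and cycles

module _ {A : Set} where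

  unique-∷ : ∀ {v : A} {vs} → v ∉ vs → Unique vs → Unique (v ∷ vs)
  unique-∷ v∉ uvs = Allₚ.¬Any⇒All¬ _ v∉ ∷ uvs

  unique-head : ∀ {v : A} {vs} → Unique (v ∷ vs) → v ∉ vs
  unique-head (v∉ ∷ _) p = All.lookup v∉ p refl

  unique-tail : ∀ {v : A} {vs} → Unique (v ∷ vs) → Unique vs
  unique-tail (_ ∷ uvs) = uvs

  unique-++ : ∀ {xs ys : List A} → Unique xs → Unique ys → (∀ {v} → v ∈ xs → v ∉ ys) → Unique (xs ++ ys)
  unique-++ uxs uys dis = Uₚ.++⁺ uxs uys λ (p , q) → dis p q

  unique-++⁻ : ∀ (xs : List A) {ys} → Unique (xs ++ ys) →
               Unique xs × Unique ys × (∀ {v} → v ∈ xs → v ∉ ys)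
  unique-++⁻ []       u = [] , u , λ ()
  unique-++⁻ (x ∷ xs) u with unique-++⁻ xs (unique-tail u)
  ... | uxs , uys , dis = unique-∷ (unique-head u ∘ ∈-++⁺ˡ) uxs , uys ,
        λ { (here refl) q → unique-head u (∈-++⁺ʳ xs q) ; (there p) → dis p }

  final : A → List A → A
  final h []       = h
  final h (x ∷ xs) = final x xs

  final-∷ʳ : ∀ h xs (b : A) → final h (xs ∷ʳ b) ≡ b
  final-∷ʳ h []       b = refl
  final-∷ʳ h (x ∷ xs) b = final-∷ʳ x xs b

  ∈-∷ʳ⁻ : ∀ xs {b v : A} → v ∈ xs ∷ʳ b → v ∈ xs ⊎ v ≡ b
  ∈-∷ʳ⁻ xs p with ∈-++⁻ xs p
  ... | inj₁ q        = inj₁ q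
  ... | inj₂ (here e) = inj₂ e

  unique-∷ʳ : ∀ {xs} {b : A} → Unique xs → b ∉ xs → Unique (xs ∷ʳ b)
  unique-∷ʳ u b∉ = unique-++ u ([] ∷ []) λ { p (here refl) → b∉ p }

  length-∷ʳ : ∀ xs (b : A) → length (xs ∷ʳ b) ≡ suc (length xs)
  length-∷ʳ xs b = trans (Lₚ.length-++ xs) (ℕₚ.+-comm _ 1)

record SGraph (N : ℕ) : Set₁ where
  infix 4 _~_ _~?_
  field
    _~_    : Fin N → Fin N → Set
    _~?_   : ∀ u v → Dec (u ~ v)
    ~-sym  : ∀ {u v} → u ~ v → v ~ u
    ~-irr  : ∀ {v} → ¬ (v ~ v)

  nbr : Fin N → DSet N
  nbr v = dset (v ~_) (v ~?_)

module _ {N : ℕ} (G : SGraph N) where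
  open SGraph G

  -- A walk whose list of vertices omits the start and includes the end, so that the
  -- length of the list is the number of edges and a closed Path with Unique list is a cycle.
  data Path : Fin N → Fin N → List (Fin N) → Set where
    []  : ∀ {u} → Path u u []
    _∷_ : ∀ {u v w vs} → u ~ w → Path w v vs → Path u v (w ∷ vs)

module _ {N : ℕ} {G : SGraph N} where
  open SGraph G

  infixr 5 _++ᵖ_

  _++ᵖ_ : ∀ {u v w xs ys} → Path G u v xs → Path G v w ys → Path G u w (xs ++ ys)
  []      ++ᵖ q = q
  (e ∷ p) ++ᵖ q = e ∷ (p ++ᵖ q)

  end∈ : ∀ {u v vs} → Path G u v vs → v ∈ u ∷ vs
  end∈ []      = here refl
  end∈ (e ∷ p) = there (end∈ p)

  split-path : ∀ {a b v vs} → Path G a b vs → v ∈ vs →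
               ∃[ xs ] ∃[ ys ] vs ≡ xs ++ ys × Path G a v xs × Path G v b ys
  split-path (e ∷ p) (here refl) = [ _ ] , _ , refl , e ∷ [] , p
  split-path (e ∷ p) (there q) with split-path p q
  ... | xs , ys , refl , p₁ , p₂ = _ ∷ xs , ys , refl , e ∷ p₁ , p₂

  -- Reversal changes which end the list omits: `b` leaves it and `a` becomes its last entry.
  -- Distinctness is therefore stated for start and list together.
  reverse-path : ∀ {a b vs} → Path G a b vs → Unique (a ∷ vs) →
                 ∃[ ws ] Path G b a ws × Unique (b ∷ ws) × length ws ≡ length vs ×
                         (∀ {v} → v ∈ ws → v ∈ a ∷ vs)
  reverse-path [] u = [] , [] , u , refl , λ ()
  reverse-path {a} {b} {w ∷ vs} (e ∷ p) u with reverse-path p (unique-tail u)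
  ... | ws , q , uws , len , sub =
        ws ∷ʳ a , q ++ᵖ (~-sym e ∷ []) , unique-∷ʳ uws a∉ , trans (length-∷ʳ ws a) (cong suc len) , sub′
    where
    a∉ : a ∉ b ∷ ws
    a∉ (here refl) = unique-head u (end∈ p)
    a∉ (there r)   = unique-head u (sub r)
    sub′ : ∀ {v} → v ∈ ws ∷ʳ a → v ∈ a ∷ w ∷ vs
    sub′ r with ∈-∷ʳ⁻ ws r
    ... | inj₁ r′   = there (sub r′)
    ... | inj₂ refl = here refl

  rotate : ∀ {a v cs} → Path G a a cs → Unique cs → v ∈ cs →
           ∃[ ds ] Path G v v ds × Unique ds × length ds ≡ length cs × (∀ {w} → w ∈ ds → w ∈ cs)
  rotate p u v∈ with split-path p v∈
  ... | xs , ys , refl , p₁ , p₂ with unique-++⁻ xs u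
  ...   | uxs , uys , dis = ys ++ xs , p₂ ++ᵖ p₁ , unique-++ uys uxs (λ r s → dis s r) ,
          trans (Lₚ.length-++ ys) (trans (ℕₚ.+-comm (length ys) _) (sym (Lₚ.length-++ xs))) ,
          λ r → [ ∈-++⁺ʳ xs , ∈-++⁺ˡ ]′ (∈-++⁻ ys r)

  -- Between consecutive vertices of `h ∷ hs` a fresh common neighbour in `S` is inserted. `D` holds
  -- the prescribed vertices and the neighbours already used; it gains one entry whenever `hs` loses
  -- one, so the last hypothesis persists. The start `h` may recur in `hs`, which lets the walk
  -- close.
  alternate : (S : DSet N) (k : ℕ) (h : Fin N) (hs D : List (Fin N)) →
              (∀ {a b} → a ∈ h ∷ hs → b ∈ h ∷ hs → k ≤ card (S ∩ (nbr a ∩ nbr b))) →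
              Unique hs → (∀ {v} → v ∈ hs → v ∈ D) → length D +ℕ length hs ≤ k →
              ∃[ vs ] Path G h (final h hs) vs × Unique vs × length vs ≡ 2 *ℕ length hs ×
                      (∀ {v} → v ∈ vs → v ∈ hs ⊎ (mem S v × v ∉ D))
  alternate S k h [] D rich u sub le = [] , [] , [] , refl , λ ()
  alternate S k h (x ∷ xs) D rich u sub le
    with pick (S ∩ (nbr h ∩ nbr x)) D
              (ℕₚ.<-≤-trans (ℕₚ.m<m+n _ z<s) (ℕₚ.≤-trans le (rich (here refl) (there (here refl)))))
  ... | q , (Sq , h~q , x~q) , q∉D
    with alternate S k x xs (q ∷ D) (λ p r → rich (there p) (there r)) (unique-tail u)
                   (there ∘ sub ∘ there) (subst (_≤ k) (ℕₚ.+-suc (length D) _) le)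
  ... | vs , p , uvs , len , vsub =
        q ∷ x ∷ vs , h~q ∷ (~-sym x~q ∷ p) , unique-∷ q∉ (unique-∷ x∉ uvs) ,
        trans (cong (2 +ℕ_) len) (sym (ℕₚ.*-suc 2 (length xs))) , vsub′
    where
    x∉ : x ∉ vs
    x∉ r = [ unique-head u , (λ z → proj₂ z (there (sub (here refl)))) ]′ (vsub r)
    q∉ : q ∉ x ∷ vs
    q∉ (here refl) = q∉D (sub (here refl))
    q∉ (there r)   = [ q∉D ∘ sub ∘ there , (λ z → proj₂ z (here refl)) ]′ (vsub r)
    vsub′ : ∀ {v} → v ∈ q ∷ x ∷ vs → v ∈ x ∷ xs ⊎ (mem S v × v ∉ D)
    vsub′ (here refl)         = inj₂ (Sq , q∉D)
    vsub′ (there (here refl)) = inj₁ (here refl)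
    vsub′ (there (there r)) with vsub r
    ... | inj₁ z        = inj₁ (there z)
    ... | inj₂ (s , z∉) = inj₂ (s , z∉ ∘ there)

  -- Alternation along `hs ∷ʳ h` returns to `h`. This list is both the route and the initial
  -- forbidden list, which accounts for the factor 2 in the number of common neighbours.
  alternating-cycle : (S : DSet N) (h : Fin N) (hs : List (Fin N)) → Unique (h ∷ hs) →
                      (∀ {a b} → a ∈ h ∷ hs → b ∈ h ∷ hs →
                        2 *ℕ suc (length hs) ≤ card (S ∩ (nbr a ∩ nbr b))) →
                      ∃[ vs ] Path G h h vs × Unique vs × length vs ≡ 2 *ℕ suc (length hs) ×
                              (∀ {v} → v ∈ vs → v ∈ h ∷ hs ⊎ mem S v)
  alternating-cycle S h hs u rich
    with alternate S (2 *ℕ suc (length hs)) h (hs ∷ʳ h) (hs ∷ʳ h)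
           (λ p q → rich (swap p) (swap q)) (unique-∷ʳ (unique-tail u) (unique-head u)) id
           (ℕₚ.≤-reflexive (trans (cong₂ _+ℕ_ (length-∷ʳ hs h) (length-∷ʳ hs h))
                                  (cong (suc (length hs) +ℕ_) (sym (ℕₚ.+-identityʳ _)))))
    where
    swap : ∀ {v} → v ∈ h ∷ (hs ∷ʳ h) → v ∈ h ∷ hs
    swap (here e) = here e
    swap (there p) with ∈-∷ʳ⁻ hs p
    ... | inj₁ q    = there q
    ... | inj₂ refl = here refl
  ... | vs , p , uvs , len , sub =
        vs , subst (λ z → Path G h z vs) (final-∷ʳ h hs h) p , uvs ,
        trans len (cong (2 *ℕ_) (length-∷ʳ hs h)) , sub′
    where
    sub′ : ∀ {v} → v ∈ vs → v ∈ h ∷ hs ⊎ mem S v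
    sub′ r with sub r
    ... | inj₂ (s , _) = inj₂ s
    ... | inj₁ q with ∈-∷ʳ⁻ hs q
    ...   | inj₁ q′   = inj₁ (there q′)
    ...   | inj₂ refl = inj₁ (here refl)

  -- Dirac's count. An edge of the path is charged once if its second vertex lies in `P` and once if
  -- its first lies in `Q`. If no edge is charged twice, there are at most `length vs` charges. The
  -- end `y` begins no edge, so it has to lie outside `Q`.
  crossing : ∀ {x y vs} (P Q : DSet N) → Path G x y vs → ¬ mem Q y →
             (∃[ p ] ∃[ q ] ∃[ xs ] ∃[ ys ] vs ≡ xs ++ q ∷ ys × Path G x p xs × Path G q y ys × mem Q p × mem P q)
             ⊎ length (filter (mem? P) vs) +ℕ length (filter (mem? Q) (x ∷ vs)) ≤ length vs
  crossing {x} P Q [] ¬Qy with mem? Q x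
  ... | yes q = contradiction q ¬Qy
  ... | no _  = inj₂ z≤n
  crossing {x} {y} {w ∷ vs} P Q (e ∷ p) ¬Qy with crossing P Q p ¬Qy
  ... | inj₁ (a , b , xs , ys , refl , p₁ , p₂ , qa , pb) =
        inj₁ (a , b , w ∷ xs , ys , refl , e ∷ p₁ , p₂ , qa , pb)
  ... | inj₂ le with mem? Q x | mem? P w
  ...   | yes q | yes r = inj₁ (x , w , [] , vs , refl , [] , p , q , r)
  ...   | no _  | yes _ = inj₂ (s≤s le)
  ...   | no _  | no _  = inj₂ (ℕₚ.m≤n⇒m≤1+n le)
  ...   | yes _ | no _  =
          inj₂ (subst (_≤ suc (length vs)) (sym (ℕₚ.+-suc (length (filter (mem? P) vs)) _)) (s≤s le))

  PathIn : DSet N → ℕ → Set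
  PathIn F k = ∃[ a ] ∃[ b ] ∃[ vs ] Path G a b vs × Unique (a ∷ vs) × length vs ≡ k ×
                                     (∀ {v} → v ∈ a ∷ vs → mem F v)

  module _ (F : DSet N) (n : ℕ)
           (deg : ∀ {v} → mem F v → n ≤ card (nbr v ∩ F))
           (leave : ∀ {x} {l : List (Fin N)} → x ∈ l → (∀ {v} → v ∈ l → mem F v) → length l <ℕ 2 *ℕ n →
                    ∃[ v ] ∃[ w ] v ∈ l × mem F w × w ∉ l × v ~ w) where

    -- Dirac: if no end of the path can be extended, a crossing pair closes it up to a cycle
    -- on the same vertices, which is then opened at a vertex with a neighbour outside.
    longer : ∀ {k} → suc k <ℕ 2 *ℕ n → PathIn F k → PathIn F (suc k)
    longer {k} k< (a , b , vs , p , u , len , sub)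
      with Fₚ.any? (λ w → mem? F w ×-dec (¬? (w ∈? a ∷ vs) ×-dec (b ~? w)))
         | Fₚ.any? (λ w → mem? F w ×-dec (¬? (w ∈? a ∷ vs) ×-dec (a ~? w)))
    ... | yes (w , Fw , w∉ , b~w) | _ =
          a , w , vs ∷ʳ w , p ++ᵖ (b~w ∷ []) , unique-∷ʳ u w∉ , trans (length-∷ʳ vs w) (cong suc len) ,
          λ r → [ sub , (λ { refl → Fw }) ]′ (∈-∷ʳ⁻ (a ∷ vs) r)
    ... | no _ | yes (w , Fw , w∉ , a~w) =
          w , b , a ∷ vs , ~-sym a~w ∷ p , unique-∷ w∉ u , cong suc len ,
          λ { (here refl) → Fw ; (there r) → sub r }
    ... | no ¬b | no ¬a with crossing (nbr a) (nbr b) p ~-irr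
    ...   | inj₂ le = ⊥-elim (ℕₚ.<⇒≱ k< (begin
            2 *ℕ n                        ≡⟨ cong (n +ℕ_) (ℕₚ.+-identityʳ n) ⟩
            n +ℕ n                        ≤⟨ ℕₚ.+-mono-≤ (deg (sub (here refl))) (deg (sub (end∈ p))) ⟩
            card (nbr a ∩ F) +ℕ card (nbr b ∩ F)
              ≤⟨ ℕₚ.+-mono-≤ (card-≤-length (nbr a ∩ F) _ inA) (card-≤-length (nbr b ∩ F) _ inB) ⟩
            length (filter (a ~?_) vs) +ℕ length (filter (b ~?_) (a ∷ vs))  ≤⟨ le ⟩
            length vs                     ≡⟨ len ⟩
            k                             ≤⟨ ℕₚ.n≤1+n k ⟩
            suc k                         ∎))
      where
      open ℕₚ.≤-Reasoning
      inB : ∀ v → b ~ v × mem F v → v ∈ filter (b ~?_) (a ∷ vs)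
      inB v (b~v , Fv) = ∈-filter⁺ (b ~?_)
        (decidable-stable (v ∈? a ∷ vs) λ v∉ → ¬b (v , Fv , v∉ , b~v)) b~v
      inA : ∀ v → a ~ v × mem F v → v ∈ filter (a ~?_) vs
      inA v (a~v , Fv) with decidable-stable (v ∈? a ∷ vs) (λ v∉ → ¬a (v , Fv , v∉ , a~v))
      ... | here refl = contradiction a~v ~-irr
      ... | there r   = ∈-filter⁺ (a ~?_) r a~v
    ...   | inj₁ (s , t , xs , ys , refl , p₁ , p₂ , b~s , a~t)
          with unique-++⁻ xs (unique-tail u)
    ...     | uxs , uys , dis with reverse-path p₂ uys
    ...       | zs , r , uzs , lzs , subz = result
      where
      -- From `a` along the path to `s`, across to `b`, backwards to `t`, and across to `a`.
      cyc : List (Fin N)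
      cyc = xs ++ (b ∷ zs) ∷ʳ a
      closed : Path G a a cyc
      closed = p₁ ++ᵖ (~-sym b~s ∷ r) ++ᵖ (~-sym a~t ∷ [])
      zs⊆ : ∀ {v} → v ∈ b ∷ zs → v ∈ t ∷ ys
      zs⊆ (here refl) = end∈ p₂
      zs⊆ (there q)   = subz q
      u-cyc : Unique cyc
      u-cyc = unique-++ uxs (unique-∷ʳ uzs (unique-head u ∘ ∈-++⁺ʳ xs ∘ zs⊆)) dis′
        where
        dis′ : ∀ {v} → v ∈ xs → v ∉ (b ∷ zs) ∷ʳ a
        dis′ q q′ with ∈-∷ʳ⁻ (b ∷ zs) q′
        ... | inj₁ q″   = dis q (zs⊆ q″)
        ... | inj₂ refl = unique-head u (∈-++⁺ˡ q)
      cyc⊆ : ∀ {v} → v ∈ cyc → v ∈ a ∷ xs ++ t ∷ ys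
      cyc⊆ q with ∈-++⁻ xs q
      ... | inj₁ q′ = there (∈-++⁺ˡ q′)
      ... | inj₂ q′ with ∈-∷ʳ⁻ (b ∷ zs) q′
      ...   | inj₁ q″   = there (∈-++⁺ʳ xs (zs⊆ q″))
      ...   | inj₂ refl = here refl
      len-cyc : length cyc ≡ suc k
      len-cyc = begin
        length cyc                               ≡⟨ Lₚ.length-++ xs ⟩
        length xs +ℕ length ((b ∷ zs) ∷ʳ a)      ≡⟨ cong (length xs +ℕ_) (length-∷ʳ (b ∷ zs) a) ⟩
        length xs +ℕ suc (suc (length zs))       ≡⟨ cong (λ z → length xs +ℕ suc (suc z)) lzs ⟩
        length xs +ℕ suc (suc (length ys))       ≡⟨ ℕₚ.+-suc (length xs) _ ⟩
        suc (length xs +ℕ length (t ∷ ys))       ≡⟨ cong suc (Lₚ.length-++ xs) ⟨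
        suc (length (xs ++ t ∷ ys))              ≡⟨ cong suc len ⟩
        suc k                                    ∎
        where open ≡-Reasoning
      result : PathIn F (suc k)
      -- The rotated cycle without its first edge is a path that ends in `v`; appending `w` gives
      -- `k + 2` vertices, hence `k + 1` edges.
      result with leave {l = cyc} (∈-++⁺ʳ xs (here refl)) (sub ∘ cyc⊆) (subst (_<ℕ 2 *ℕ n) (sym len-cyc) k<)
      ... | v , w , v∈ , Fw , w∉ , v~w with rotate closed u-cyc v∈
      ...   | []     , _     , _  , lds , _    with () ← trans lds len-cyc
      ...   | x ∷ ds , e ∷ q , ud , lds , ds⊆ =
              x , w , ds ∷ʳ w , q ++ᵖ (v~w ∷ []) , unique-∷ʳ ud (w∉ ∘ ds⊆) ,
              trans (length-∷ʳ ds w) (trans lds len-cyc) ,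
              λ z → [ sub ∘ cyc⊆ ∘ ds⊆ , (λ { refl → Fw }) ]′ (∈-∷ʳ⁻ (x ∷ ds) z)

    long-path : ∀ {v} → mem F v → ∀ k → k <ℕ 2 *ℕ n → PathIn F k
    long-path {v} Fv zero    _  = v , v , [] , [] , [] ∷ [] , refl , λ { (here refl) → Fv }
    long-path     Fv (suc k) k< = longer k< (long-path Fv k (ℕₚ.<-trans (ℕₚ.n<1+n k) k<))

-- Expansion

infixl 6 _⊕_
infixr 7 _⊛_

_⊕_ : ∀ {a b c d} → a ≤ b → c ≤ d → a +ℕ c ≤ b +ℕ d
_⊕_ = ℕₚ.+-mono-≤

_⊛_ : ∀ {a b} k → a ≤ b → k *ℕ a ≤ k *ℕ b
k ⊛ h = ℕₚ.*-monoʳ-≤ k h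

flip-parity : ∀ k → parity k ≡ 1ℙ → parity (suc k) ≡ 0ℙ
flip-parity (suc zero)    _  = refl
flip-parity (suc (suc k)) eq = flip-parity k eq

even-half : ∀ k → parity k ≡ 0ℙ → ∃[ j ] k ≡ 2 *ℕ j
even-half zero          _  = 0 , refl
even-half (suc (suc k)) eq with even-half k eq
... | j , refl = suc j , cong suc (sym (ℕₚ.+-suc j (j +ℕ 0)))

module _ {N : ℕ} (G : SGraph N) where
  open SGraph G

  boundary : DSet N → DSet N
  boundary X = dset (λ v → ¬ mem X v × ∃[ w ] mem X w × w ~ v)
                    (λ v → ¬? (mem? X v) ×-dec Fₚ.any? (λ w → mem? X w ×-dec (w ~? v)))

  -- The vertex y witnesses that the far side A ∖ X ∖ boundary X of the cut is not empty.
  Separated : DSet N → DSet N → Set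
  Separated A X = X ⊆ A × (∃[ x ] mem X x) × (∃[ y ] mem A y × ¬ mem X y × ¬ mem (boundary X) y)

  Expanding : DSet N → ℕ → Set₁
  Expanding A e = ∀ X → Separated A X → e <ℕ card (boundary X)

  -- Decidable sets cannot be enumerated, but the subset vectors can. If no vector is a cut, no
  -- decidable set `X` is one either, since the vector of its decisions has the same members and a
  -- boundary no larger.
  expanding-or-cut : ∀ A e → Expanding A e ⊎ (∃[ X ] Separated A X × card (boundary X) ≤ e)
  expanding-or-cut A e with Subₚ.anySubset? {P = Cut} cut?
    where
    toDSet : Sub.Subset N → DSet N
    toDSet S = dset (Sub._∈ S) (Subₚ._∈? S)
    Cut : Sub.Subset N → Set
    Cut S = Separated A (toDSet S) × card (boundary (toDSet S)) ≤ e
    cut? : ∀ S → Dec (Cut S)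
    cut? S = (Fₚ.all? (λ v → mem? X v →-dec mem? A v)
              ×-dec (Fₚ.any? (mem? X)
              ×-dec Fₚ.any? (λ y → mem? A y ×-dec (¬? (mem? X y) ×-dec ¬? (mem? (boundary X) y)))))
             ×-dec (card (boundary X) ≤? e)
      where X = toDSet S
  ... | yes (S , cut) = inj₂ (dset (Sub._∈ S) (Subₚ._∈? S) , cut)
  ... | no ¬cut = inj₁ λ X (X⊆A , (x , Xx) , y , Ay , ¬Xy , ¬∂y) → ℕₚ.≰⇒> λ small →
        let S : Sub.Subset N
            S = Vec.tabulate (does ∘ mem? X)
            Y = dset (Sub._∈ S) (Subₚ._∈? S)
            to : ∀ {v} → v Sub.∈ S → mem X v
            to {v} p = does-true (mem? X v)
              (trans (sym (Vecₚ.lookup∘tabulate (does ∘ mem? X) v)) (Vecₚ.[]=⇒lookup p))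
            from : ∀ {v} → mem X v → v Sub.∈ S
            from {v} p = Vecₚ.lookup⇒[]= v S
              (trans (Vecₚ.lookup∘tabulate (does ∘ mem? X) v) (dec-true (mem? X v) p))
            ∂-to : boundary Y ⊆ boundary X
            ∂-to v = λ (v∉ , w , w∈ , a) → v∉ ∘ from , w , to w∈ , a
        in ¬cut (S , ((λ v → X⊆A v ∘ to) , (x , from Xx) , y , Ay , ¬Xy ∘ to , ¬∂y ∘ ∂-to y) ,
                 ℕₚ.≤-trans (card-mono (boundary Y) (boundary X) ∂-to) small)
    where
    does-true : ∀ {P : Set} (P? : Dec P) → does P? ≡ true → P
    does-true (yes p) _ = p

module Expander {N : ℕ} (G : SGraph N) (A : DSet N) (edge⊆A : ∀ {u v} → SGraph._~_ G u v → mem A u)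
                (e c : ℕ) (0<e : 0 <ℕ e) (N≤ : N ≤ c *ℕ e) (expanding : Expanding G A e) where
  open SGraph G

  -- A radius that reaches everything: while a vertex of `A` outside the forbidden list is missing,
  -- each round adds at least `e / 2` vertices, so `2c + 1` rounds would give more than `c e`, hence
  -- more than `N`.
  K : ℕ
  K = suc (2 *ℕ c)

  module Ball (D : List (Fin N)) (o : Fin N) where

    sphere : DSet N → DSet N
    sphere X = dset (λ v → v ∉ D × ∃[ w ] mem X w × w ~ v)
                    (λ v → ¬? (v ∈? D) ×-dec Fₚ.any? (λ w → mem? X w ×-dec (w ~? v)))

    -- Breadth-first search from `o` that never enters `D`, although the root `o` itself may lie
    -- there.
    ball layer : ℕ → DSet N
    ball zero    = ⟪ [ o ] ⟫
    ball (suc i) = ball i ∪ sphere (ball i)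

    layer zero    = ⟪ [ o ] ⟫
    layer (suc i) = ball (suc i) ∖ ball i

    ball-mono : ∀ {i j} → i ≤ j → ball i ⊆ ball j
    ball-mono i≤j = go (ℕₚ.≤⇒≤′ i≤j)
      where
      go : ∀ {i j} → i ℕ.≤′ j → ball i ⊆ ball j
      go ℕ.≤′-refl       v p = p
      go (ℕ.≤′-step i≤j) v p = inj₁ (go i≤j v p)

    centre∈ : ∀ i → mem (ball i) o
    centre∈ i = ball-mono {0} {i} z≤n o (here refl)

    ball-avoids : ∀ i {v} → mem (ball i) v → v ≡ o ⊎ v ∉ D
    ball-avoids zero    (here eq)       = inj₁ eq
    ball-avoids (suc i) (inj₁ p)        = ball-avoids i p
    ball-avoids (suc i) (inj₂ (v∉ , _)) = inj₂ v∉

    -- A vertex enters layer `r + 1` through some `w` in `ball r`; were `w` in an earlier ball, the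
    -- vertex would have entered earlier. So each edge descends exactly one layer, which fixes the
    -- length and makes the path simple.
    layer-path : ∀ r {v} → mem (layer (suc r)) v →
                 ∃[ vs ] Path G v o vs × Unique vs × length vs ≡ suc r × (∀ {w} → w ∈ vs → mem (ball r) w)
    layer-path r       (inj₁ p , v∉) = contradiction p v∉
    layer-path zero    (inj₂ (_ , w , here refl , w~v) , v∉) =
      [ o ] , ~-sym w~v ∷ [] , [] ∷ [] , refl , id
    layer-path (suc r) (inj₂ (v∉D , w , Bw , w~v) , v∉) with layer-path r {w} (Bw , w∉)
      where
      w∉ : ¬ mem (ball r) w
      w∉ Bw′ = v∉ (inj₂ (v∉D , w , Bw′ , w~v))
    ... | vs , p , u , len , sub =
          w ∷ vs , ~-sym w~v ∷ p , unique-∷ (λ w∈ → v∉ (inj₂ (v∉D , w , sub w∈ , w~v))) u , cong suc len ,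
          λ { (here refl) → Bw ; (there q) → inj₁ (sub q) }

    ball-layer : ∀ i {v} → mem (ball i) v → ∃[ r ] r ≤ i × mem (layer r) v
    ball-layer zero    p = 0 , z≤n , p
    ball-layer (suc i) {v} p with mem? (ball i) v
    ... | no ¬q = suc i , ℕₚ.≤-refl , p , ¬q
    ... | yes q with ball-layer i q
    ...   | r , r≤i , l = r , ℕₚ.m≤n⇒m≤1+n r≤i , l

    ball-path : ∀ i {v} → mem (ball i) v →
                ∃[ vs ] Path G v o vs × Unique (v ∷ vs) × length vs ≤ i × (∀ {w} → w ∈ vs → mem (ball i) w)
    ball-path i p with ball-layer i p
    ... | zero  , _   , here refl = [] , [] , [] ∷ [] , z≤n , λ ()
    ... | suc r , r<i , l with layer-path r l
    ...   | vs , q , u , len , sub =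
            vs , q , unique-∷ (proj₂ l ∘ sub) u , subst (_≤ i) (sym len) r<i ,
            λ {w} → ball-mono (ℕₚ.<⇒≤ r<i) w ∘ sub

    module _ (Ao : mem A o) (small : 2 *ℕ length D ≤ e) where

      ball⊆A : ∀ i → ball i ⊆ A
      ball⊆A zero    v (here refl)              = Ao
      ball⊆A (suc i) v (inj₁ p)                 = ball⊆A i v p
      ball⊆A (suc i) v (inj₂ (_ , w , _ , w~v)) = edge⊆A (~-sym w~v)

      -- As long as `v` is missing from the next ball, it lies outside the present ball and its
      -- boundary. Expansion then gives more than `e` boundary vertices, of which `D` blocks at most
      -- `e / 2`.
      growth : ∀ i {v} → mem A v → v ∉ D → ¬ mem (ball i) v → i *ℕ e ≤ 2 *ℕ card (ball i)
      growth zero    _  _   _  = z≤n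
      growth (suc i) {v} Av v∉D v∉ =
        arith i e (card B) (card (ball (suc i))) (card (boundary G B)) (card (boundary G B ∖ ⟪ D ⟫)) (length D)
              (growth i Av v∉D (v∉ ∘ inj₁))
              (expanding B (ball⊆A i , (o , centre∈ i) , v , Av , v∉ ∘ inj₁ ,
                            λ (_ , w , Bw , w~v) → v∉ (inj₂ (v∉D , w , Bw , w~v))))
              (card-∖-list (boundary G B) D)
              (card-disjoint (ball (suc i)) B (boundary G B ∖ ⟪ D ⟫) (λ _ → inj₁)
                (λ _ ((_ , adj) , w∉D) → inj₂ (w∉D , adj)) (λ _ p q → proj₁ (proj₁ q) p))
              small
        where
        B = ball i
        arith : ∀ i e b b′ d d′ l → i *ℕ e ≤ 2 *ℕ b → suc e ≤ d → d ≤ d′ +ℕ l → b +ℕ d′ ≤ b′ →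
                2 *ℕ l ≤ e → suc i *ℕ e ≤ 2 *ℕ b′
        arith i e b b′ d d′ l h₁ h₂ h₃ h₄ h₅ =
          linear 2 (h₁ ⊕ 2 ⊛ h₂ ⊕ 2 ⊛ h₃ ⊕ 2 ⊛ h₄ ⊕ h₅) (solve (i ◂ e ◂ b ◂ b′ ◂ d ◂ d′ ◂ l ◂ ∎ₗ))

      opaque
        reach : ∀ {v} → mem A v → v ∉ D → mem (ball K) v
        reach {v} Av v∉D = decidable-stable (mem? (ball K) v) λ v∉ →
          ℕₚ.<⇒≱ 0<e (arith e c _ _ (growth K Av v∉D v∉) (card-≤ (ball K)) N≤)
          where
          arith : ∀ e c b N → suc (2 *ℕ c) *ℕ e ≤ 2 *ℕ b → b ≤ N → N ≤ c *ℕ e → e ≤ 0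
          arith e c b N h₁ h₂ h₃ = linear 0 (h₁ ⊕ 2 ⊛ h₂ ⊕ 2 ⊛ h₃) (solve (e ◂ c ◂ b ◂ N ◂ ∎ₗ))

  opaque
    -- The search is rooted at `b`, so `b` may belong to `D`. So may `a`: it is filtered out of the
    -- forbidden list, and the simple path found does not return to it.
    connect : ∀ D {a b} → 2 *ℕ length D ≤ e → mem A a → mem A b →
              ∃[ vs ] Path G a b vs × Unique (a ∷ vs) × length vs ≤ K × (∀ {v} → v ∈ vs → v ∈ D → v ≡ b)
    connect D {a} {b} small Aa Ab =
      let vs , p , u , len , sub = ball-path K (reach Ab small′ Aa a∉)
          avoid : ∀ {v} → v ∈ vs → v ∈ D → v ≡ b
          avoid v∈ v∈D = [ id , (λ v∉ → ⊥-elim (v∉ (∈-filter⁺ keep? v∈D λ { refl → unique-head u v∈ }))) ]′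
                           (ball-avoids K (sub v∈))
      in vs , p , u , len , avoid
      where
      keep? : ∀ v → Dec (v ≢ a)
      keep? v = ¬? (v Fₚ.≟ a)
      open Ball (filter keep? D) b
      small′ : 2 *ℕ length (filter keep? D) ≤ e
      small′ = ℕₚ.≤-trans (2 ⊛ Lₚ.length-filter keep? D) small
      a∉ : a ∉ filter keep? D
      a∉ p = proj₂ (∈-filter⁻ keep? {xs = D} p) refl

  opaque
    -- If some layer of a breadth-first search spans an edge z z′, then the root o is reached from z by
    -- two paths whose lengths differ by one; otherwise every closed walk through o is even.
    parity-switch : ∀ {o} → mem A o →
      ∃[ s ] ∃[ t ] ∃[ W ] mem A s × mem A t × s ∉ W × length W ≤ suc (2 *ℕ K) ×
        (∀ {ws} → Path G t s ws →
          ∃[ vs ] Path G s t vs × Unique vs × length vs ≤ suc K × (∀ {v} → v ∈ vs → v ∈ W) ×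
                  parity (length ws +ℕ length vs) ≡ 0ℙ)
    parity-switch {o} Ao
      with Fₚ.any? {K} (λ r → Fₚ.any? (λ z → Fₚ.any? (λ z′ →
             mem? (layer (suc (toℕ r))) z ×-dec (mem? (layer (suc (toℕ r))) z′ ×-dec (z ~? z′)))))
      where open Ball [] o
    ... | yes (r , z , z′ , lz , lz′ , z~z′) with Ball.layer-path [] o (toℕ r) lz | Ball.layer-path [] o (toℕ r) lz′
    ...   | vs , p , u , len , sub | vs′ , p′ , u′ , len′ , sub′ =
            -- The direct descent has one edge fewer than the one through `z′`; `W` reserves both,
            -- since the choice depends on a walk not yet known.
            z , o , vs ++ z′ ∷ vs′ , edge⊆A z~z′ , Ao , z∉ , bound , choose
      where
      z∉ : z ∉ vs ++ z′ ∷ vs′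
      z∉ q with ∈-++⁻ vs q
      ... | inj₁ q′          = proj₂ lz (sub q′)
      ... | inj₂ (here refl) = ~-irr z~z′
      ... | inj₂ (there q′)  = proj₂ lz (sub′ q′)
      bound : length (vs ++ z′ ∷ vs′) ≤ suc (2 *ℕ K)
      bound = subst (_≤ suc (2 *ℕ K))
        (sym (trans (Lₚ.length-++ vs) (cong₂ _+ℕ_ len (cong suc len′))))
        (arith (Fₚ.toℕ<n r))
        where
        arith : ∀ {r k} → suc r ≤ k → suc r +ℕ suc (suc r) ≤ suc (2 *ℕ k)
        arith {r} {k} h = linear 0 (2 ⊛ h) (solve (r ◂ k ◂ ∎ₗ))
      choose : ∀ {ws} → Path G o z ws →
        ∃[ xs ] Path G z o xs × Unique xs × length xs ≤ suc K × (∀ {v} → v ∈ xs → v ∈ vs ++ z′ ∷ vs′) ×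
                parity (length ws +ℕ length xs) ≡ 0ℙ
      choose {ws} _ with parity (length ws +ℕ suc (toℕ r)) in eq
      ... | 0ℙ = vs , p , u , subst (_≤ suc K) (sym len) (ℕₚ.m≤n⇒m≤1+n (Fₚ.toℕ<n r)) , ∈-++⁺ˡ ,
                 trans (cong (λ x → parity (length ws +ℕ x)) len) eq
      ... | 1ℙ = z′ ∷ vs′ , z~z′ ∷ p′ , unique-∷ (proj₂ lz′ ∘ sub′) u′ ,
                 s≤s (subst (_≤ K) (sym len′) (Fₚ.toℕ<n r)) , ∈-++⁺ʳ vs ,
                 trans (cong parity (trans (cong (λ x → length ws +ℕ suc x) len′) (ℕₚ.+-suc (length ws) _)))
                       (flip-parity (length ws +ℕ suc (toℕ r)) eq)
    parity-switch {o} Ao | no ¬edge = o , o , [] , Ao , Ao , (λ ()) , z≤n , λ p →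
        [] , [] , [] , z≤n , (λ ()) , walk-parity 0 z≤n (here refl) p
      where
      open Ball [] o
      small : 2 *ℕ 0 ≤ e
      small = z≤n
      far : ∀ r r′ {u w} → mem (layer r) u → mem (layer r′) w → u ~ w → r′ ≤ suc r
      far r r′ lu lw u~w with r′ ≤? suc r
      ... | yes le = le
      far r zero lu lw u~w | no ≰ = z≤n
      far r (suc r′) {u} {w} lu lw u~w | no ≰ = ⊥-elim (proj₂ lw (ball-mono (s≤s⁻¹ (ℕₚ.≰⇒> ≰)) w
          (inj₂ ((λ ()) , u , in-ball r lu , u~w))))
        where
        in-ball : ∀ r {u} → mem (layer r) u → mem (ball r) u
        in-ball zero    p = p
        in-ball (suc r) p = proj₁ p
      distinct : ∀ r → r ≤ K → ∀ {u w} → mem (layer r) u → mem (layer r) w → u ~ w → ⊥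
      distinct zero    _   (here refl) (here refl) a = ~-irr a
      distinct (suc r) r<K {u} {w} lu lw a = ¬edge (fromℕ< r<K , u , w ,
        subst (λ i → mem (layer (suc i)) u) (sym (Fₚ.toℕ-fromℕ< r<K)) lu ,
        subst (λ i → mem (layer (suc i)) w) (sym (Fₚ.toℕ-fromℕ< r<K)) lw , a)
      -- By `far` and `distinct` every edge joins consecutive layers, so each edge flips the parity
      -- of the layer index.
      walk-parity : ∀ r {u ws} → r ≤ K → mem (layer r) u → Path G u o ws → parity (length ws +ℕ r) ≡ 0ℙ
      walk-parity zero    _ _        []      = refl
      walk-parity (suc r) _ (_ , o∉) []      = contradiction (centre∈ r) o∉
      walk-parity r r≤K lu (_∷_ {w = w} {vs = ws} a p) =
        let r′ , r′≤K , lw = ball-layer K (reach Ao small (edge⊆A (~-sym a)) (λ ()))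
        in consecutive r′ (far r r′ lu lw a) (far r′ r lw lu (~-sym a))
             (λ eq → distinct r r≤K lu (subst (λ i → mem (layer i) w) (sym eq) lw) a) (walk-parity r′ r′≤K lw p)
        where
        consecutive : ∀ r′ → r′ ≤ suc r → r ≤ suc r′ → r ≢ r′ → parity (length ws +ℕ r′) ≡ 0ℙ →
                      parity (suc (length ws) +ℕ r) ≡ 0ℙ
        consecutive r′ le ge ≢ ih with ℕₚ.<-cmp r r′
        ... | tri< lt _ _ = trans (cong parity (sym (trans (cong (length ws +ℕ_) (ℕₚ.≤-antisym le lt))
                                                           (ℕₚ.+-suc (length ws) r)))) ih
        ... | tri≈ _ eq _ = contradiction eq ≢
        ... | tri> _ _ gt = trans (cong (parity ∘ suc) (trans (cong (length ws +ℕ_) (ℕₚ.≤-antisym ge gt))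
                                                              (ℕₚ.+-suc (length ws) r′))) ih

-- Bicliques and dominating lists

opaque
  unfolding card

  double-count : ∀ {N} (R : Fin N → Fin N → Set) (R? : ∀ u v → Dec (R u v)) →
                 sum (λ u → card (dset (R u) (R? u))) ≡
                 sum (λ v → card (dset (λ u → R u v) (λ u → R? u v)))
  double-count {N} R R? = ∑-comm {N} {N} (λ u v → indicator (R? u v))

  card-*-≤-sum : ∀ {N} (X : DSet N) k (f : Fin N → ℕ) → (∀ v → mem X v → k ≤ f v) → card X *ℕ k ≤ sum f
  card-*-≤-sum X k f h = subst (_≤ sum f) (sum-*ʳ (χ X) k) (sum-mono pointwise)
    where
    pointwise : ∀ v → indicator (mem? X v) *ℕ k ≤ f v
    pointwise v with mem? X v
    ... | no _  = z≤n
    ... | yes x = subst (_≤ f v) (sym (ℕₚ.+-identityʳ k)) (h v x)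

module Dense {N : ℕ} (G : SGraph N) (A : DSet N) (edge⊆A : ∀ {u v} → SGraph._~_ G u v → mem A u)
             (e c : ℕ) (0<e : 0 <ℕ e) (0<c : 0 <ℕ c) (N≤ : N ≤ c *ℕ e)
             (degree : ∀ {v} → mem A v → e ≤ card (SGraph.nbr G v)) where
  open SGraph G

  opaque
    -- Double counting of the edges from `U` to vertices outside `D`. Every vertex of `U` keeps at
    -- least `e / 2` of them. If each `h` met fewer than `card U / 2c`, the total would be below
    -- `N * card U / 2c`, which is at most `card U * e / 2`.
    average : ∀ D (U : DSet N) → 2 *ℕ length D ≤ e → U ⊆ A → 0 <ℕ card U →
              ∃[ h ] mem A h × h ∉ D × card U ≤ 2 *ℕ c *ℕ card (nbr h ∩ U)
    average D U small U⊆A 0<U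
      with Fₚ.any? (λ h → mem? A h ×-dec (¬? (h ∈? D) ×-dec (card U ≤? 2 *ℕ c *ℕ card (nbr h ∩ U))))
    ... | yes found = found
    ... | no ¬found = ⊥-elim (absurd (card U) 0<U refl)
      where
      R : Fin N → Fin N → Set
      R u h = mem U u × u ~ h × h ∉ D
      R? : ∀ u h → Dec (R u h)
      R? u h = mem? U u ×-dec ((u ~? h) ×-dec ¬? (h ∈? D))
      row column : Fin N → DSet N
      row u    = dset (R u) (R? u)
      column h = dset (λ u → R u h) (λ u → R? u h)
      T : ℕ
      T = sum (card ∘ row)
      row-bound : ∀ u → mem U u → e ≤ card (row u) *ℕ 2
      row-bound u Uu = arith e _ _ _ (degree (U⊆A u Uu)) (card-∖-list (nbr u) D)
                         (card-mono (nbr u ∖ ⟪ D ⟫) (row u) (λ h p → Uu , p)) small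
        where
        arith : ∀ e d d′ l {r} → e ≤ d → d ≤ d′ +ℕ l → d′ ≤ r → 2 *ℕ l ≤ e → e ≤ r *ℕ 2
        arith e d d′ l {r} h₁ h₂ h₃ h₄ =
          linear 0 (2 ⊛ h₁ ⊕ 2 ⊛ h₂ ⊕ 2 ⊛ h₃ ⊕ h₄) (solve (e ◂ d ◂ d′ ◂ l ◂ r ◂ ∎ₗ))
      lower : card U *ℕ e ≤ T *ℕ 2
      lower = subst (card U *ℕ e ≤_) (sum-*ʳ (card ∘ row) 2) (card-*-≤-sum U e _ row-bound)
      -- With `card U` written as `suc p`, the strict inequality for a column becomes a bound by `p`
      -- and survives summation.
      column-bound : ∀ p → card U ≡ suc p → ∀ h → card (column h) *ℕ (2 *ℕ c) ≤ p
      column-bound p eq h = cases (mem? A h) (h ∈? D)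
        where
        open ℕₚ.≤-Reasoning
        cases : Dec (mem A h) → Dec (h ∈ D) → card (column h) *ℕ (2 *ℕ c) ≤ p
        cases (no ¬A)  _        = subst (λ x → x *ℕ (2 *ℕ c) ≤ p)
            (sym (ℕₚ.n≤0⇒n≡0 (card-empty (column h) λ u (_ , u~h , _) → ¬A (edge⊆A (~-sym u~h))))) z≤n
        cases (yes _)  (yes h∈) = subst (λ x → x *ℕ (2 *ℕ c) ≤ p)
            (sym (ℕₚ.n≤0⇒n≡0 (card-empty (column h) λ u (_ , _ , h∉) → h∉ h∈))) z≤n
        cases (yes Ah) (no h∉)  = s≤s⁻¹ (begin
            suc (card (column h) *ℕ (2 *ℕ c))      ≡⟨ cong suc (ℕₚ.*-comm (card (column h)) (2 *ℕ c)) ⟩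
            suc (2 *ℕ c *ℕ card (column h))
              ≤⟨ s≤s (ℕₚ.*-monoʳ-≤ (2 *ℕ c) (card-mono (column h) (nbr h ∩ U)
                        (λ u (Uu , u~h , _) → ~-sym u~h , Uu))) ⟩
            suc (2 *ℕ c *ℕ card (nbr h ∩ U))       ≤⟨ ℕₚ.≰⇒> (λ le → ¬found (h , Ah , h∉ , le)) ⟩
            card U                                 ≡⟨ eq ⟩
            suc p                                  ∎)
      upper : ∀ p → card U ≡ suc p → T *ℕ (2 *ℕ c) ≤ N *ℕ p
      upper p eq = begin
        T *ℕ (2 *ℕ c)                             ≡⟨ cong (_*ℕ (2 *ℕ c)) (double-count R R?) ⟩
        sum (card ∘ column) *ℕ (2 *ℕ c)           ≡⟨ sum-*ʳ (card ∘ column) (2 *ℕ c) ⟨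
        sum (λ h → card (column h) *ℕ (2 *ℕ c))   ≤⟨ sum-mono (column-bound p eq) ⟩
        sum {N} (λ _ → p)                         ≡⟨ sum-const N p ⟩
        N *ℕ p                                    ∎
        where open ℕₚ.≤-Reasoning
      absurd : ∀ k → 0 <ℕ k → card U ≡ k → ⊥
      absurd (suc p) _ eq = ℕₚ.<⇒≱ (ℕₚ.*-mono-< 0<c 0<e)
        (arith e c T p N (c ⊛ subst (λ k → k *ℕ e ≤ T *ℕ 2) eq lower) (upper p eq) (ℕₚ.*-monoˡ-≤ p N≤))
        where
        arith : ∀ e c T p N → c *ℕ (suc p *ℕ e) ≤ c *ℕ (T *ℕ 2) → T *ℕ (2 *ℕ c) ≤ N *ℕ p →
                N *ℕ p ≤ c *ℕ e *ℕ p → c *ℕ e ≤ 0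
        arith e c T p N h₁ h₂ h₃ = linear 0 (h₁ ⊕ h₂ ⊕ h₃) (solve (e ◂ c ◂ T ◂ p ◂ N ◂ ∎ₗ))

  opaque
    -- Hubs are added greedily: averaging over the current common neighbourhood `W` yields a hub
    -- that keeps at least a fraction `1 / 2c` of it. The earlier hubs join `D` as forbidden
    -- vertices.
    biclique : ∀ D (U : DSet N) T → 2 *ℕ (T +ℕ length D) ≤ e → U ⊆ A → 0 <ℕ card U →
               ∃[ hs ] ∃[ W ] length hs ≡ T × Unique hs × (∀ {v} → v ∈ hs → mem A v × v ∉ D) ×
                              W ⊆ U × (∀ {h w} → h ∈ hs → mem W w → h ~ w) × card U ≤ (2 *ℕ c) ^ T *ℕ card W
    biclique D U zero    _     _   _   =
      [] , U , refl , [] , (λ ()) , (λ _ → id) , (λ ()) , ℕₚ.≤-reflexive (sym (ℕₚ.*-identityˡ _))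
    biclique D U (suc T) small U⊆A 0<U
      with biclique D U T (ℕₚ.≤-trans (2 ⊛ ℕₚ.n≤1+n _) small) U⊆A 0<U
    ... | hs , W , refl , u , avoid , W⊆U , adj , dense =
          let h , Ah , h∉ , large = average (hs ++ D) W
                (subst (λ k → 2 *ℕ k ≤ e) (sym (Lₚ.length-++ hs)) (ℕₚ.≤-trans (2 ⊛ ℕₚ.n≤1+n _) small))
                (λ v → U⊆A v ∘ W⊆U v) (positive ((2 *ℕ c) ^ length hs) 0<U dense)
          in h ∷ hs , nbr h ∩ W , refl , unique-∷ (h∉ ∘ ∈-++⁺ˡ) u ,
             (λ { (here refl) → Ah , h∉ ∘ ∈-++⁺ʳ hs ; (there p) → avoid p }) ,
             (λ v → W⊆U v ∘ proj₂) ,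
             (λ { (here refl) q → proj₁ q ; (there p) q → adj p (proj₂ q) }) ,
             ℕₚ.≤-trans dense (ℕₚ.≤-trans (ℕₚ.*-monoʳ-≤ ((2 *ℕ c) ^ length hs) large)
               (ℕₚ.≤-reflexive (regroup (2 *ℕ c) ((2 *ℕ c) ^ length hs) (card (nbr h ∩ W)))))
      where
      regroup : ∀ x y z → y *ℕ (x *ℕ z) ≡ x *ℕ y *ℕ z
      regroup = solve-∀
      positive : ∀ {a b} k → 0 <ℕ a → a ≤ k *ℕ b → 0 <ℕ b
      positive {b = suc b}     _ _   _  = z<s
      positive {a} {b = zero} k 0<a le = ⊥-elim (ℕₚ.<⇒≱ 0<a (subst (a ≤_) (ℕₚ.*-zeroʳ k) le))

  -- The number of rounds of domination. Each unfinished round adds `e` to `s e` while `8 c card U`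
  -- drops by more than that; as `8 c N` is at most `8 c^2 e`, there cannot be `8 c^2 + 1` such
  -- rounds.
  S : ℕ
  S = suc (8 *ℕ (c *ℕ c))

  Dominated : List (Fin N) → Set₁
  Dominated D = ∃[ H ] ∃[ U ] length H ≤ S × (∀ {v} → v ∈ H → mem A v × v ∉ D) × 4 *ℕ card U ≤ e ×
                              (∀ {x} → mem A x → ¬ mem U x → ∃[ h ] h ∈ H × x ~ h)

  opaque
    -- As long as more than e / 4 vertices of A are missed, the best vertex hits a further e / 8c of them.
    dominate : ∀ D → 2 *ℕ length D ≤ e → Dominated D
    dominate D small = finish (rounds S)
      where
      Hits : List (Fin N) → DSet N → Set
      Hits H U = (∀ {v} → v ∈ H → mem A v × v ∉ D) × U ⊆ A ×
                 (∀ {x} → mem A x → ¬ mem U x → ∃[ h ] h ∈ H × x ~ h)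
      State : ℕ → Set₁
      State s = ∃[ H ] ∃[ U ] length H ≤ s × Hits H U ×
                              (4 *ℕ card U ≤ e ⊎ s *ℕ e +ℕ 8 *ℕ c *ℕ card U ≤ 8 *ℕ c *ℕ N)
      rounds : ∀ s → State s
      rounds zero = [] , A , z≤n , ((λ ()) , (λ _ → id) , λ Ax ¬Ax → contradiction Ax ¬Ax) ,
                    inj₂ (ℕₚ.*-monoʳ-≤ (8 *ℕ c) (card-≤ A))
      rounds (suc s) with rounds s
      ... | H , U , len , hits , inj₁ done = H , U , ℕₚ.m≤n⇒m≤1+n len , hits , inj₁ done
      ... | H , U , len , hits , inj₂ le with 4 *ℕ card U ≤? e
      ...   | yes done = H , U , ℕₚ.m≤n⇒m≤1+n len , hits , inj₁ done
      ...   | no ≰ =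
              let H⊆ , U⊆A , hit = hits
                  h , Ah , h∉ , large = average D U small U⊆A (positive (ℕₚ.≰⇒> ≰))
              in h ∷ H , U ∖ nbr h , s≤s len ,
                 ((λ { (here refl) → Ah , h∉ ; (there p) → H⊆ p }) , (λ v → U⊆A v ∘ proj₁) ,
                  λ {x} Ax ¬U → extend {U} H h Ax ¬U hit) ,
                 inj₂ (arith s e c (card U) (card (U ∖ nbr h)) _ N (ℕₚ.≰⇒> ≰) large
                        (card-disjoint U (U ∖ nbr h) (nbr h ∩ U) (λ _ → proj₁) (λ _ → proj₂)
                          (λ v p q → proj₂ p (proj₁ q))) le)
        where
        positive : e <ℕ 4 *ℕ card U → 0 <ℕ card U
        positive lt with card U
        ... | zero  = contradiction lt (λ ())
        ... | suc _ = z<s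
        extend : ∀ {U} H h {x} → mem A x → ¬ (mem U x × ¬ (h ~ x)) →
                 (∀ {x} → mem A x → ¬ mem U x → ∃[ h ] h ∈ H × x ~ h) → ∃[ h′ ] h′ ∈ h ∷ H × x ~ h′
        extend {U} H h {x} Ax ¬U hit with mem? U x
        ... | yes Ux = h , here refl , ~-sym (decidable-stable (h ~? x) λ ≁ → ¬U (Ux , ≁))
        ... | no ¬Ux with hit Ax ¬Ux
        ...   | h′ , h′∈ , a = h′ , there h′∈ , a
        arith : ∀ s e c u u′ g N → suc e ≤ 4 *ℕ u → u ≤ 2 *ℕ c *ℕ g → u′ +ℕ g ≤ u →
                s *ℕ e +ℕ 8 *ℕ c *ℕ u ≤ 8 *ℕ c *ℕ N → suc s *ℕ e +ℕ 8 *ℕ c *ℕ u′ ≤ 8 *ℕ c *ℕ N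
        arith s e c u u′ g N h₁ h₂ h₃ h₄ =
          linear 1 (h₁ ⊕ 4 ⊛ h₂ ⊕ (8 *ℕ c) ⊛ h₃ ⊕ h₄) (solve (s ◂ e ◂ c ◂ u ◂ u′ ◂ g ◂ N ◂ ∎ₗ))
      finish : State S → Dominated D
      finish (H , U , len , (H⊆ , _ , hit) , inj₁ done) = H , U , len , H⊆ , done , hit
      finish (H , U , len , _ , inj₂ le) = ⊥-elim (ℕₚ.<⇒≱ 0<e (arith e c (card U) N le (ℕₚ.*-monoʳ-≤ (8 *ℕ c) N≤)))
        where
        arith : ∀ e c u N → suc (8 *ℕ (c *ℕ c)) *ℕ e +ℕ 8 *ℕ c *ℕ u ≤ 8 *ℕ c *ℕ N →
                8 *ℕ c *ℕ N ≤ 8 *ℕ c *ℕ (c *ℕ e) → e ≤ 0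
        arith e c u N h₁ h₂ = linear (8 *ℕ c *ℕ u) (h₁ ⊕ h₂) (solve (e ◂ c ◂ u ◂ N ◂ ∎ₗ))

-- Cycles of prescribed even length in an expander

-- The search radius `K`, restated so that the constants depend on `c` alone.
diam : ℕ → ℕ
diam c = suc (2 *ℕ c)

opaque
  links spread core reserve threshold : ℕ → ℕ
  -- With `K = diam c`, two funnel legs of at most `K + 1` edges and a connection with parity switch
  -- of at most `2K + 1` stay below `4K + 4`, twice `links c`. `spread` allows for `S` routes of
  -- `K + 1` vertices.
  links c     = 2 *ℕ diam c +ℕ 2
  spread c    = suc (8 *ℕ (c *ℕ c)) *ℕ suc (diam c)
  -- core counts the vertices of the parity switch and the biclique; reserve adds all connecting paths.
  core c      = suc (2 *ℕ links c) +ℕ suc (links c) +ℕ (2 +ℕ suc (2 *ℕ diam c))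
  reserve c   = spread c +ℕ (spread c +ℕ (diam c +ℕ core c))
  -- The first summand leaves `reserve c` common neighbours to `links c + 1` hubs; the second keeps
  -- every reserved list within `e / 2`.
  threshold c = (2 *ℕ c) ^ suc (links c) *ℕ reserve c +ℕ 2 *ℕ reserve c

  core≤reserve : ∀ c → core c ≤ reserve c
  core≤reserve c = ℕₚ.≤-trans (ℕₚ.m≤n+m _ (diam c)) (ℕₚ.≤-trans (ℕₚ.m≤n+m _ (spread c)) (ℕₚ.m≤n+m _ (spread c)))

  spread+core≤reserve : ∀ c → spread c +ℕ (spread c +ℕ (diam c +ℕ core c)) ≤ reserve c
  spread+core≤reserve c = ℕₚ.≤-refl

  links+switch≤core : ∀ c → suc (2 *ℕ links c) +ℕ suc (links c) +ℕ (2 +ℕ suc (2 *ℕ diam c)) ≤ core c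
  links+switch≤core c = ℕₚ.≤-refl

  routes≤spread : ∀ c → suc (8 *ℕ (c *ℕ c)) *ℕ suc (diam c) ≤ spread c
  routes≤spread c = ℕₚ.≤-refl

  links-value : ∀ c → links c ≡ 2 *ℕ diam c +ℕ 2
  links-value c = refl

  links≤core : ∀ c → 2 *ℕ links c ≤ core c
  links≤core c = ℕₚ.≤-trans (ℕₚ.n≤1+n _) (ℕₚ.≤-trans (ℕₚ.m≤m+n _ _) (ℕₚ.m≤m+n _ _))

  reserve≤threshold : ∀ c → 2 *ℕ reserve c ≤ threshold c
  reserve≤threshold c = ℕₚ.m≤n+m _ _

  power≤threshold : ∀ c → (2 *ℕ c) ^ suc (links c) *ℕ reserve c ≤ threshold c
  power≤threshold c = ℕₚ.m≤m+n _ _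

opaque
  ++-bound : ∀ {X : Set} (xs : List X) {ys a b} → length xs ≤ a → length ys ≤ b → length (xs ++ ys) ≤ a +ℕ b
  ++-bound xs h k = subst (_≤ _) (sym (Lₚ.length-++ xs)) (ℕₚ.+-mono-≤ h k)

length-++₃ : ∀ {X : Set} (xs ys zs : List X) → length (xs ++ ys ++ zs) ≡ length xs +ℕ (length ys +ℕ length zs)
length-++₃ xs ys zs = trans (Lₚ.length-++ xs) (cong (length xs +ℕ_) (Lₚ.length-++ ys))

opaque
  -- Here `a` and `b` are the legs, `p` is the long path and `r` the connection with parity switch.
  -- Without the zigzag the length is an even number `2h`, and `h < n` because
  -- `a + b + r ≤ 4K + 3 < 2q`. The zigzag supplies the missing `2 (n - h)`, at most `2q` since the
  -- long path takes `2k`.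
  balance : ∀ K {a b p r q k n} → a ≤ suc K → b ≤ suc K → r ≤ K +ℕ suc K → p ≡ 2 *ℕ k → q ≡ 2 *ℕ K +ℕ 2 →
            q +ℕ k ≡ n → parity (a +ℕ (p +ℕ b) +ℕ r) ≡ 0ℙ →
            ∃[ i ] i <ℕ q × a +ℕ (p +ℕ (b +ℕ (2 *ℕ suc i +ℕ r))) ≡ 2 *ℕ n
  balance K {a} {b} {r = r} {k = k} ha hb hr refl refl refl even with even-half (a +ℕ (2 *ℕ k +ℕ b) +ℕ r) even
  ... | h , half with ℕₚ.m≤n⇒∃[o]m+o≡n {suc h} (ℕₚ.*-cancelˡ-< 2 h (2 *ℕ K +ℕ 2 +ℕ k) (below half))
    where
    below : a +ℕ (2 *ℕ k +ℕ b) +ℕ r ≡ 2 *ℕ h → 2 *ℕ h <ℕ 2 *ℕ (2 *ℕ K +ℕ 2 +ℕ k)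
    below half = linear 0 (ha ⊕ hb ⊕ hr ⊕ ℕₚ.≤-reflexive (sym half)) (solve (K ◂ a ◂ b ◂ r ◂ k ◂ h ◂ ∎ₗ))
  ...   | i , eq = i , i< , total
    where
    i< : i <ℕ 2 *ℕ K +ℕ 2
    i< = ℕₚ.*-cancelˡ-≤ 2 (linear (a +ℕ b +ℕ r) (ℕₚ.≤-reflexive half ⊕ 2 ⊛ ℕₚ.≤-reflexive eq)
                                   (solve (K ◂ a ◂ b ◂ r ◂ k ◂ h ◂ i ◂ ∎ₗ)))
    total : a +ℕ (2 *ℕ k +ℕ (b +ℕ (2 *ℕ suc i +ℕ r))) ≡ 2 *ℕ (2 *ℕ K +ℕ 2 +ℕ k)
    total = begin
      a +ℕ (2 *ℕ k +ℕ (b +ℕ (2 *ℕ suc i +ℕ r)))  ≡⟨ solve (a ◂ b ◂ r ◂ k ◂ i ◂ ∎ₗ) ⟩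
      a +ℕ (2 *ℕ k +ℕ b) +ℕ r +ℕ 2 *ℕ suc i      ≡⟨ cong (_+ℕ 2 *ℕ suc i) half ⟩
      2 *ℕ h +ℕ 2 *ℕ suc i                       ≡⟨ solve (h ◂ i ◂ ∎ₗ) ⟩
      2 *ℕ (suc h +ℕ i)                          ≡⟨ cong (2 *ℕ_) eq ⟩
      2 *ℕ (2 *ℕ K +ℕ 2 +ℕ k)                    ∎
      where open ≡-Reasoning

opaque
  card-∪₃ : ∀ {N e} (U V : DSet N) (l : List (Fin N)) → 4 *ℕ card U ≤ e → 4 *ℕ card V ≤ e → 2 *ℕ length l ≤ e →
            card (U ∪ (V ∪ ⟪ l ⟫)) ≤ e
  card-∪₃ {e = e} U V l hU hV hl = ℕₚ.*-cancelˡ-≤ 4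
    (arith e _ (card U) (card (V ∪ ⟪ l ⟫)) (card V) (card ⟪ l ⟫) (length l)
      (card-cover _ U (V ∪ ⟪ l ⟫) (λ _ → id)) (card-cover _ V ⟪ l ⟫ (λ _ → id))
      (card-≤-length ⟪ l ⟫ l (λ _ → id)) hU hV hl)
    where
    arith : ∀ e x u y v z l → x ≤ u +ℕ y → y ≤ v +ℕ z → z ≤ l → 4 *ℕ u ≤ e → 4 *ℕ v ≤ e → 2 *ℕ l ≤ e →
            4 *ℕ x ≤ 4 *ℕ e
    arith e x u y v z l h₁ h₂ h₃ h₄ h₅ h₆ =
      linear 0 (4 ⊛ h₁ ⊕ 4 ⊛ h₂ ⊕ 4 ⊛ h₃ ⊕ h₄ ⊕ h₅ ⊕ 2 ⊛ h₆) (solve (e ◂ x ◂ u ◂ y ◂ v ◂ z ◂ l ◂ ∎ₗ))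

module Assembly {N : ℕ} (G : SGraph N) (A : DSet N) (edge⊆A : ∀ {u v} → SGraph._~_ G u v → mem A u)
                (e c : ℕ) (0<e : 0 <ℕ e) (0<c : 0 <ℕ c) (N≤ : N ≤ c *ℕ e) (enough : threshold c ≤ e) (n : ℕ)
                (degree : ∀ {v} → mem A v → n +ℕ e ≤ card (SGraph.nbr G v)) where
  open SGraph G
  open Dense G A edge⊆A e c 0<e 0<c N≤ (λ Av → ℕₚ.≤-trans (ℕₚ.m≤n+m e n) (degree Av))

  Cycle : ℕ → Set
  Cycle k = ∃[ u ] ∃[ vs ] Path G u u vs × Unique vs × length vs ≡ k

  reserve≤ : 2 *ℕ reserve c ≤ e
  reserve≤ = ℕₚ.≤-trans (reserve≤threshold c) enough

  opaque
    dense-bound : ∀ {T} (W : DSet N) → e ≤ card A → T ≤ suc (links c) → card A ≤ (2 *ℕ c) ^ T *ℕ card W →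
                  reserve c ≤ card W
    dense-bound {T} W e≤ T≤ le = ℕₚ.*-cancelˡ-≤ ((2 *ℕ c) ^ suc (links c)) {{power≢0}} (begin
      (2 *ℕ c) ^ suc (links c) *ℕ reserve c  ≤⟨ power≤threshold c ⟩
      threshold c                            ≤⟨ ℕₚ.≤-trans enough (ℕₚ.≤-trans e≤ le) ⟩
      (2 *ℕ c) ^ T *ℕ card W                 ≤⟨ ℕₚ.*-monoˡ-≤ (card W) (ℕₚ.^-monoʳ-≤ (2 *ℕ c) {{base≢0}} T≤) ⟩
      (2 *ℕ c) ^ suc (links c) *ℕ card W     ∎)
      where
      open ℕₚ.≤-Reasoning
      base≢0 : NonZero (2 *ℕ c)
      base≢0 = >-nonZero (ℕₚ.*-mono-< {0} {2} z<s 0<c)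
      power≢0 : NonZero ((2 *ℕ c) ^ suc (links c))
      power≢0 = ℕₚ.m^n≢0 (2 *ℕ c) (suc (links c)) {{base≢0}}

    short≤reserve : n ≤ links c → 2 *ℕ n ≤ reserve c
    short≤reserve n≤ = ℕₚ.≤-trans (2 ⊛ n≤) (ℕₚ.≤-trans (links≤core c) (core≤reserve c))

    short-cycle : e ≤ card A → 0 <ℕ n → n ≤ links c → Cycle (2 *ℕ n)
    short-cycle e≤ 0<n n≤
      with biclique [] A n (ℕₚ.≤-trans (2 ⊛ ℕₚ.≤-trans (ℕₚ.≤-reflexive (ℕₚ.+-identityʳ n))
                                                      (ℕₚ.≤-trans (ℕₚ.m≤m+n n _) (short≤reserve n≤))) reserve≤)
                    (λ _ → id) (ℕₚ.<-≤-trans 0<e e≤)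
    ... | []     , W , len  , _ = ⊥-elim (ℕₚ.<-irrefl len 0<n)
    ... | h ∷ hs , W , len , u , _ , _ , adj , le
      with alternating-cycle {G = G} W h hs u (λ p q → ℕₚ.≤-trans
            (subst (λ k → 2 *ℕ k ≤ reserve c) (sym len) (short≤reserve n≤))
             (ℕₚ.≤-trans (dense-bound W e≤ (ℕₚ.m≤n⇒m≤1+n n≤) le) (card-mono W _ (λ v w → w , adj p w , adj q w))))
    ... | vs , p , uvs , lvs , _ = h , vs , p , uvs , trans lvs (cong (2 *ℕ_) len)

    -- Deleting `X` costs each degree and the size of `A` at most `e`, which the surplus covers;
    -- Dirac's extension then runs with degree `n` on at least `2n` vertices.
    avoiding-path : Expanding G A e → 2 *ℕ n +ℕ e ≤ card A → (X : DSet N) → card X ≤ e → ∀ k → k <ℕ 2 *ℕ n →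
                    PathIn {G = G} (A ∖ X) k
    avoiding-path expanding large X small k k< =
      long-path F n deg leave (proj₁ (proj₂ start)) k k<
      where
      F : DSet N
      F = A ∖ X
      outside : ∀ (Y : DSet N) → Y ⊆ A → ∀ v → mem Y v → (mem Y v × mem F v) ⊎ mem X v
      outside Y Y⊆A v y with mem? X v
      ... | yes x = inj₂ x
      ... | no ¬x = inj₁ (y , Y⊆A v y , ¬x)
      card-F : 2 *ℕ n ≤ card F
      card-F = ℕₚ.+-cancelʳ-≤ e _ _ (begin
        2 *ℕ n +ℕ e              ≤⟨ large ⟩
        card A                   ≤⟨ card-cover A (A ∩ F) X (outside A (λ _ → id)) ⟩
        card (A ∩ F) +ℕ card X   ≤⟨ ℕₚ.+-mono-≤ (card-mono (A ∩ F) F (λ _ → proj₂)) small ⟩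
        card F +ℕ e              ∎)
        where open ℕₚ.≤-Reasoning
      start : ∃[ v ] mem F v × v ∉ []
      start = pick F [] (ℕₚ.<-≤-trans (ℕₚ.≤-<-trans z≤n k<) card-F)
      deg : ∀ {v} → mem F v → n ≤ card (nbr v ∩ F)
      deg {v} Fv = ℕₚ.+-cancelʳ-≤ e _ _ (begin
        n +ℕ e                       ≤⟨ degree (proj₁ Fv) ⟩
        card (nbr v)                 ≤⟨ card-cover (nbr v) (nbr v ∩ F) X (outside (nbr v) (λ _ → edge⊆A ∘ ~-sym)) ⟩
        card (nbr v ∩ F) +ℕ card X   ≤⟨ ℕₚ.+-monoʳ-≤ _ small ⟩
        card (nbr v ∩ F) +ℕ e        ∎)
        where open ℕₚ.≤-Reasoning
      -- Otherwise the whole boundary of l would lie in X, which has too few elements.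
      leave : ∀ {x} {l : List (Fin N)} → x ∈ l → (∀ {v} → v ∈ l → mem F v) → length l <ℕ 2 *ℕ n →
              ∃[ v ] ∃[ w ] v ∈ l × mem F w × w ∉ l × v ~ w
      leave {x} {l} x∈ l⊆F short
        with Fₚ.any? (λ v → Fₚ.any? (λ w → (v ∈? l) ×-dec (mem? F w ×-dec (¬? (w ∈? l) ×-dec (v ~? w)))))
      ... | yes found = found
      ... | no ¬found = ⊥-elim (ℕₚ.<⇒≱ (expanding ⟪ l ⟫ separated)
                                 (ℕₚ.≤-trans (card-mono (boundary G ⟪ l ⟫) X ∂⊆X) small))
        where
        separated : Separated G A ⟪ l ⟫
        separated with pick F l (ℕₚ.<-≤-trans short card-F)
        ... | y , Fy , y∉ = (λ v v∈ → proj₁ (l⊆F v∈)) , (x , x∈) , y , proj₁ Fy , y∉ ,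
                            λ (_ , w , w∈ , w~y) → ¬found (w , y , w∈ , Fy , y∉ , w~y)
        ∂⊆X : boundary G ⟪ l ⟫ ⊆ X
        ∂⊆X v (v∉ , w , w∈ , w~v) = decidable-stable (mem? X v) λ ¬Xv →
          ¬found (w , v , w∈ , (edge⊆A (~-sym w~v) , ¬Xv) , v∉ , w~v)

  opaque
    -- The ends `u` and `u′` are hubs of a biclique. A zigzag through `i` further hubs, with common
    -- neighbours in between, has length `2 (i + 1)`; all of them stay in `B`, so `B` can be
    -- reserved before `i` is known.
    ladder : ∀ D → length D ≤ 2 +ℕ suc (2 *ℕ diam c) → e ≤ card A →
             ∃[ u ] ∃[ u′ ] ∃[ B ] mem A u × mem A u′ × u ∈ B × u′ ∈ B × (∀ {v} → v ∈ B → v ∉ D) ×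
               length B ≤ suc (2 *ℕ links c) +ℕ suc (links c) ×
               (∀ i → i <ℕ links c → ∃[ vs ] Path G u u′ vs × Unique vs × u ∉ vs × (∀ {v} → v ∈ vs → v ∈ B) ×
                                             length vs ≡ 2 *ℕ suc i)
    ladder D |D| e≤ = build (biclique D A (suc (links c)) room (λ _ → id) (ℕₚ.<-≤-trans 0<e e≤))
      where
      core-room : suc (2 *ℕ links c) +ℕ suc (links c) +ℕ length D ≤ reserve c
      core-room = ℕₚ.≤-trans (ℕₚ.+-monoʳ-≤ (suc (2 *ℕ links c) +ℕ suc (links c)) |D|)
                             (ℕₚ.≤-trans (links+switch≤core c) (core≤reserve c))
      room : 2 *ℕ (suc (links c) +ℕ length D) ≤ e
      room = ℕₚ.≤-trans (2 ⊛ ℕₚ.≤-trans (ℕₚ.+-monoˡ-≤ (length D)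
            (ℕₚ.m≤n+m (suc (links c)) (suc (2 *ℕ links c)))) core-room)
                        reserve≤
      room′ : suc (2 *ℕ links c) +ℕ length D ≤ reserve c
      room′ = ℕₚ.≤-trans (ℕₚ.+-monoˡ-≤ (length D) (ℕₚ.m≤m+n (suc (2 *ℕ links c)) (suc (links c)))) core-room
      build : (∃[ hs ] ∃[ W ] length hs ≡ suc (links c) × Unique hs × (∀ {v} → v ∈ hs → mem A v × v ∉ D) ×
                 W ⊆ A × (∀ {h w} → h ∈ hs → mem W w → h ~ w) × card A ≤ (2 *ℕ c) ^ suc (links c) *ℕ card W) →
              ∃[ u ] ∃[ u′ ] ∃[ B ] mem A u × mem A u′ × u ∈ B × u′ ∈ B × (∀ {v} → v ∈ B → v ∉ D) ×
                length B ≤ suc (2 *ℕ links c) +ℕ suc (links c) ×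
                (∀ i → i <ℕ links c → ∃[ vs ] Path G u u′ vs × Unique vs × u ∉ vs × (∀ {v} → v ∈ vs → v ∈ B) ×
                                              length vs ≡ 2 *ℕ suc i)
      build ([] , _ , () , _)
      build (u ∷ [] , _ , len , _) =
        ⊥-elim (ℕₚ.m+1+n≢0 (2 *ℕ diam c) (trans (sym (links-value c)) (sym (ℕₚ.suc-injective len))))
      build (u ∷ u′ ∷ hs , W , len , u-hs , hs⊆ , W⊆A , adj , le)
        -- The zigzag of index `i` starts with `i + 2` forbidden vertices and makes `i + 1` stops,
        -- so it asks for `2i + 3` common neighbours, at most `2 links + 1`.
        with pick-list W D (suc (2 *ℕ links c)) (ℕₚ.≤-trans room′ (dense-bound W e≤ ℕₚ.≤-refl le))
      ... | ys , u-ys , |ys| , ys⊆ =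
            u , u′ , ys ++ u ∷ u′ ∷ hs , proj₁ (hs⊆ (here refl)) , proj₁ (hs⊆ (there (here refl))) ,
            ∈-++⁺ʳ ys (here refl) , ∈-++⁺ʳ ys (there (here refl)) ,
            (λ p → [ proj₂ ∘ ys⊆ , proj₂ ∘ hs⊆ ]′ (∈-++⁻ ys p)) ,
            ++-bound ys (ℕₚ.≤-reflexive |ys|) (ℕₚ.≤-reflexive len) , zigzag
        where
        zigzag : ∀ i → i <ℕ links c →
                 ∃[ vs ] Path G u u′ vs × Unique vs × u ∉ vs × (∀ {v} → v ∈ vs → v ∈ ys ++ u ∷ u′ ∷ hs) ×
                         length vs ≡ 2 *ℕ suc i
        zigzag i i< =
          let vs , p , u-vs , |vs| , sub = alternate {G = G} ⟪ ys ⟫ (length ys) u js (u ∷ js) rich u-js there room″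
          in vs , subst (λ z → Path G u z vs) (final-∷ʳ u (take i hs) u′) p , u-vs ,
             (λ u∈ → [ unique-head u-hs ∘ js⊆ , (λ z → proj₂ z (here refl)) ]′ (sub u∈)) ,
             (λ v∈ → [ ∈-++⁺ʳ ys ∘ there ∘ js⊆ , ∈-++⁺ˡ ∘ proj₁ ]′ (sub v∈)) ,
             trans |vs| (cong (2 *ℕ_) |js|)
          where
          js : List (Fin N)
          js = take i hs ∷ʳ u′
          take⊆ : ∀ {v} → v ∈ take i hs → v ∈ hs
          take⊆ p = subst (_ ∈_) (Lₚ.take++drop≡id i hs) (∈-++⁺ˡ p)
          js⊆ : ∀ {v} → v ∈ js → v ∈ u′ ∷ hs
          js⊆ p = [ there ∘ take⊆ , here ]′ (∈-∷ʳ⁻ (take i hs) p)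
          u-js : Unique (js)
          u-js = unique-∷ʳ (Uₚ.take⁺ i (unique-tail (unique-tail u-hs))) (unique-head (unique-tail u-hs) ∘ take⊆)
          rich : ∀ {a b} → a ∈ u ∷ js → b ∈ u ∷ js →
                 length ys ≤ card (⟪ ys ⟫ ∩ (nbr a ∩ nbr b))
          rich p q = length-≤-card (⟪ ys ⟫ ∩ (nbr _ ∩ nbr _)) ys u-ys
            λ r → r , adj (side p) (proj₁ (ys⊆ r)) , adj (side q) (proj₁ (ys⊆ r))
            where
            side : ∀ {v} → v ∈ u ∷ js → v ∈ u ∷ u′ ∷ hs
            side (here eq) = here eq
            side (there p) = there (js⊆ p)
          |js| : length js ≡ suc i
          |js| = trans (length-∷ʳ (take i hs) u′) (cong suc (trans (Lₚ.length-take i hs) (ℕₚ.m≤n⇒m⊓n≡m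
                   (s≤s⁻¹ (subst (suc i ≤_) (sym (ℕₚ.suc-injective len)) i<)))))
          room″ : suc (length (js)) +ℕ length (js) ≤ length ys
          room″ = subst₂ (λ a b → suc a +ℕ a ≤ b) (sym |js|) (sym |ys|) (arith i (links c) i<)
            where
            arith : ∀ i q → suc i ≤ q → suc (suc i) +ℕ suc i ≤ suc (2 *ℕ q)
            arith i q h = linear 0 (2 ⊛ h) (solve (i ◂ q ◂ ∎ₗ))

  module _ (expanding : Expanding G A e) where
    open Expander G A edge⊆A e c 0<e N≤ expanding

    Enters : List (Fin N) → Fin N → List (Fin N) → Fin N → Set
    Enters D b Z x = ∃[ vs ] Path G x b vs × Unique vs × (∀ {v} → v ∈ vs → v ∈ Z) × length vs ≤ suc K ×
                             (∀ {v} → v ∈ vs → v ∈ D → v ≡ b)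

    -- The ends of the long path are not known in advance, so a bounded list `Z` is reserved through
    -- which every vertex of `A` outside `U` can enter `b`.
    Funnel : List (Fin N) → Fin N → Set₁
    Funnel D b = ∃[ Z ] ∃[ U ] length Z ≤ spread c × 4 *ℕ card U ≤ e ×
                               (∀ {x} → mem A x → ¬ mem U x → Enters D b Z x)

    opaque
      -- The routes may overlap, since a walk into `b` follows a single one; each is therefore found
      -- independently.
      routes : ∀ D {b} → mem A b → 2 *ℕ length D ≤ e → ∀ H → (∀ {v} → v ∈ H → mem A v × v ∉ D) →
               ∃[ Z ] length Z ≤ length H *ℕ suc K ×
                 (∀ {h} → h ∈ H → ∃[ vs ] Path G h b vs × Unique (h ∷ vs) × (∀ {v} → v ∈ h ∷ vs → v ∈ Z) ×
                                          length vs ≤ K × (∀ {v} → v ∈ vs → v ∈ D → v ≡ b))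
      routes D Ab small []      _  = [] , z≤n , λ ()
      routes D {b} Ab small (h ∷ H) H⊆ with routes D Ab small H (H⊆ ∘ there)
                                      | connect D small (proj₁ (H⊆ (here refl))) Ab
      ... | Z , |Z| , route | vs , p , u , len , avoid =
            (h ∷ vs) ++ Z , ++-bound (h ∷ vs) (s≤s len) |Z| ,
            λ { (here refl) → vs , p , u , ∈-++⁺ˡ , len , avoid
              ; (there q)   → let ws , p′ , u′ , sub , rest = route q
                              in ws , p′ , u′ , (λ r → ∈-++⁺ʳ (h ∷ vs) (sub r)) , rest }

      funnel : ∀ D {b} → mem A b → 2 *ℕ length D ≤ e → Funnel D b
      funnel D {b} Ab small with dominate D small
      ... | H , U , |H| , H⊆ , few , hit with routes D Ab small H H⊆
      ...   | Z , |Z| , route = Z , U , ℕₚ.≤-trans |Z| (ℕₚ.≤-trans (ℕₚ.*-monoˡ-≤ (suc K) |H|)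
            (routes≤spread c)) , few , enter
        where
        enter : ∀ {x} → mem A x → ¬ mem U x → Enters D b Z x
        enter Ax ¬Ux with hit Ax ¬Ux
        ... | h , h∈ , x~h with route h∈
        ...   | vs , p , u , sub , len , avoid = h ∷ vs , x~h ∷ p , u , sub , s≤s len ,
                λ { (here refl) h∈D → contradiction h∈D (proj₂ (H⊆ h∈)) ; (there q) → avoid q }

    links>0 : 0 <ℕ links c
    links>0 = subst (0 <ℕ_) (sym (trans (links-value c) (ℕₚ.+-comm (2 *ℕ diam c) 2))) z<s

    opaque
      within : ∀ (D : List (Fin N)) B → length D ≤ B → B ≤ reserve c → 2 *ℕ length D ≤ e
      within D B h k = ℕₚ.≤-trans (2 ⊛ ℕₚ.≤-trans h k) reserve≤

    -- In completing a walk to an even cycle, r corrects the parity and i adjusts the length.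
    Completes : Fin N → Fin N → List (Fin N) → Set
    Completes u t D = ∀ {ws} → Path G t u ws →
      ∃[ r ] r ≤ K +ℕ suc K × parity (length ws +ℕ r) ≡ 0ℙ ×
        (∀ i → i <ℕ links c → ∃[ vs ] Path G u t vs × Unique vs × u ∉ vs × (∀ {v} → v ∈ vs → v ∈ D) ×
                                      length vs ≡ 2 *ℕ suc i +ℕ r)

    Flexible : Set
    Flexible = ∃[ u ] ∃[ t ] ∃[ D ] mem A u × mem A t × length D ≤ diam c +ℕ core c × Completes u t D

    opaque
      -- A zigzag leads from `u` to `u′`, a connecting path to `s`, and the parity switch to `t`.
      -- The biclique is chosen off the switch, and the connecting path meets the two only at its
      -- ends.
      flexible : ∀ {o} → mem A o → e ≤ card A → Flexible
      flexible Ao e≤ with parity-switch Ao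
      ... | s , t , W , As , At , s∉W , |W| , switch with ladder (s ∷ W) (s≤s (ℕₚ.m≤n⇒m≤1+n |W|)) e≤
      ...   | u , u′ , B , Au , Au′ , u∈B , u′∈B , apart , |B| , rungs
        with ++-bound B {s ∷ W} |B| (s≤s (ℕₚ.m≤n⇒m≤1+n |W|))
      ...   | |B+W| with connect (B ++ s ∷ W) (within (B ++ s ∷ W) _ |B+W|
            (ℕₚ.≤-trans (links+switch≤core c) (core≤reserve c))) Au′ As
      ...     | cs , p-cs , u-cs , |cs| , avoid-cs =
                u , t , cs ++ B ++ s ∷ W , Au , At ,
                ++-bound cs |cs| (ℕₚ.≤-trans |B+W| (links+switch≤core c)) , complete
        where
        s∉B : s ∉ B
        s∉B p = apart p (here refl)
        u∉cs : u ∉ cs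
        u∉cs p with avoid-cs p (∈-++⁺ˡ u∈B)
        ... | refl = s∉B u∈B
        complete : Completes u t (cs ++ B ++ s ∷ W)
        -- The parity must be settled before `i` is known. All zigzags are even, so the shortest
        -- one, with two edges, decides for all.
        complete {ws} p with rungs 0 links>0
        ... | as , p-as , _ , _ , _ , |as| with switch (p ++ᵖ p-as ++ᵖ p-cs)
        ...   | xs , p-xs , u-xs , |xs| , xs⊆ , even =
          length cs +ℕ length xs , ℕₚ.+-mono-≤ |cs| |xs| , trans (cong parity recount) even , extend
          where
          recount : 2 +ℕ (length ws +ℕ (length cs +ℕ length xs)) ≡ length (ws ++ as ++ cs) +ℕ length xs
          recount = sym (begin
            length (ws ++ as ++ cs) +ℕ length xs
              ≡⟨ cong (_+ℕ length xs) (trans (Lₚ.length-++ ws) (cong (length ws +ℕ_)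
                   (trans (Lₚ.length-++ as) (cong (_+ℕ length cs) |as|)))) ⟩
            length ws +ℕ (2 +ℕ length cs) +ℕ length xs
              ≡⟨ arith (length ws) (length cs) (length xs) ⟩
            2 +ℕ (length ws +ℕ (length cs +ℕ length xs)) ∎)
            where
            open ≡-Reasoning
            arith : ∀ w c x → w +ℕ (2 +ℕ c) +ℕ x ≡ 2 +ℕ (w +ℕ (c +ℕ x))
            arith = solve-∀
          extend : ∀ i → i <ℕ links c →
                   ∃[ vs ] Path G u t vs × Unique vs × u ∉ vs × (∀ {v} → v ∈ vs → v ∈ cs ++ B ++ s ∷ W) ×
                           length vs ≡ 2 *ℕ suc i +ℕ (length cs +ℕ length xs)
          extend i i< with rungs i i<
          ... | bs , p-bs , u-bs , u∉bs , bs⊆ , |bs| =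
            bs ++ cs ++ xs , p-bs ++ᵖ p-cs ++ᵖ p-xs ,
            unique-++ u-bs (unique-++ (unique-tail u-cs) u-xs cs∩xs) bs∩ ,
            (λ q → [ u∉bs , (λ r → [ u∉cs , u∉xs ]′ (∈-++⁻ cs r)) ]′ (∈-++⁻ bs q)) ,
            (λ q → [ ∈-++⁺ʳ cs ∘ ∈-++⁺ˡ ∘ bs⊆ , (λ r → [ ∈-++⁺ˡ ,
                  ∈-++⁺ʳ cs ∘ ∈-++⁺ʳ B ∘ there ∘ xs⊆ ]′ (∈-++⁻ cs r)) ]′
                     (∈-++⁻ bs q)) ,
            trans (Lₚ.length-++ bs) (cong₂ _+ℕ_ |bs| (Lₚ.length-++ cs))
            where
            u∉xs : u ∉ xs
            u∉xs q = apart u∈B (there (xs⊆ q))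
            cs∩xs : ∀ {v} → v ∈ cs → v ∉ xs
            cs∩xs q r with avoid-cs q (∈-++⁺ʳ B (there (xs⊆ r)))
            ... | refl = s∉W (xs⊆ r)
            bs∩ : ∀ {v} → v ∈ bs → v ∉ cs ++ xs
            bs∩ q r with ∈-++⁻ cs r
            ... | inj₂ r′ = apart (bs⊆ q) (there (xs⊆ r′))
            ... | inj₁ r′ with avoid-cs r′ (∈-++⁺ˡ (bs⊆ q))
            ...   | refl = s∉B (bs⊆ q)

      -- The cycle runs from `t` back along `bs` to `y`, along `ps` to `x`, along `as` to `u`, and
      -- through the core to `t`. Every piece avoids what was reserved before it, hence the
      -- disjointness; the reversal `rs` contains `y`, which `ps` omits.
      close : ∀ {u t D} → Completes u t D → ∀ Z₁ Z₂ {x y ps as bs} k → links c +ℕ k ≡ n →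
              Path G y x ps → Unique (y ∷ ps) → length ps ≡ 2 *ℕ k → (∀ {v} → v ∈ y ∷ ps → v ∉ Z₂ ++ Z₁ ++ D) →
              Path G x u as → Unique as → length as ≤ suc K → (∀ {v} → v ∈ as → v ∈ Z₁) →
              (∀ {v} → v ∈ as → v ∈ D → v ≡ u) →
              Path G y t bs → Unique bs → length bs ≤ suc K → (∀ {v} → v ∈ bs → v ∈ Z₂) →
              (∀ {v} → v ∈ bs → v ∈ Z₁ ++ D → v ≡ t) → Cycle (2 *ℕ n)
      close {u} {t} {D} complete Z₁ Z₂ {x} {y} {ps} {as} {bs} k split p-ps u-ps |ps| outside
            p-as u-as |as| as⊆ avoid₁ p-bs u-bs |bs| bs⊆ avoid₂
        with reverse-path p-bs (unique-∷ (λ y∈ → outside (here refl) (∈-++⁺ˡ (bs⊆ y∈))) u-bs)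
      ... | rs , p-rs , u-rs , |rs| , rs⊆ with complete (p-rs ++ᵖ p-ps ++ᵖ p-as)
      ...   | r , r≤ , even , extend
        with balance K (subst (_≤ suc K) (sym |rs|) |bs|) |as| r≤ |ps| (links-value c) split
               (trans (cong parity (cong (_+ℕ r) (sym (length-++₃ rs ps as)))) even)
      ...     | i , i< , total with extend i i<
      ...       | vs , p-vs , u-vs , u∉vs , vs⊆ , |vs| =
        t , rs ++ ps ++ as ++ vs , p-rs ++ᵖ p-ps ++ᵖ p-as ++ᵖ p-vs ,
        unique-++ (unique-tail u-rs) (unique-++ (unique-tail u-ps) (unique-++ u-as u-vs as∩vs) ps∩) rs∩ , len
        where
        len : length (rs ++ ps ++ as ++ vs) ≡ 2 *ℕ n
        len = begin
          length (rs ++ ps ++ as ++ vs)                              ≡⟨ length-++₃ rs ps (as ++ vs) ⟩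
          length rs +ℕ (length ps +ℕ length (as ++ vs))
                 ≡⟨ cong (λ z → length rs +ℕ (length ps +ℕ z)) (Lₚ.length-++ as) ⟩
          length rs +ℕ (length ps +ℕ (length as +ℕ length vs))
                 ≡⟨ cong (λ z → length rs +ℕ (length ps +ℕ (length as +ℕ z))) |vs| ⟩
          length rs +ℕ (length ps +ℕ (length as +ℕ (2 *ℕ suc i +ℕ r))) ≡⟨ total ⟩
          2 *ℕ n                                                     ∎
          where open ≡-Reasoning
        as∩vs : ∀ {v} → v ∈ as → v ∉ vs
        as∩vs q q′ with avoid₁ q (vs⊆ q′)
        ... | refl = u∉vs q′
        tail⊆ : ∀ {v} → v ∈ as ++ vs → v ∈ Z₁ ++ D
        tail⊆ q = [ ∈-++⁺ˡ ∘ as⊆ , ∈-++⁺ʳ Z₁ ∘ vs⊆ ]′ (∈-++⁻ as q)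
        ps∩ : ∀ {v} → v ∈ ps → v ∉ as ++ vs
        ps∩ q q′ = outside (there q) (∈-++⁺ʳ Z₂ (tail⊆ q′))
        rs∩ : ∀ {v} → v ∈ rs → v ∉ ps ++ as ++ vs
        rs∩ q q′ with rs⊆ q | ∈-++⁻ ps q′
        ... | here refl | inj₁ q″ = unique-head u-ps q″
        ... | here refl | inj₂ q″ = outside (here refl) (∈-++⁺ʳ Z₂ (tail⊆ q″))
        ... | there b   | inj₁ q″ = outside (there q″) (∈-++⁺ˡ (bs⊆ b))
        ... | there b   | inj₂ q″ with avoid₂ b (tail⊆ q″)
        ...   | refl = unique-head u-rs q

      -- Order of choice: the core `D`, a funnel into `u` off `D`, a funnel into `t` off `Z₁ ++ D`,
      -- and last the long path, which avoids these lists and both sets of missed vertices. The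
      -- sizes `e / 2`, `e / 4` and `e / 4` add up to the `e` that `avoiding-path` tolerates.
      long-cycle : ∀ {o} → mem A o → 2 *ℕ n +ℕ e ≤ card A → ∀ k → links c +ℕ k ≡ n → Cycle (2 *ℕ n)
      long-cycle Ao large k split = choose-core (flexible Ao (ℕₚ.≤-trans (ℕₚ.m≤n+m e _) large))
        where
        join : ∀ {u t D} → Completes u t D → ∀ Z₁ U₁ → (∀ {x} → mem A x → ¬ mem U₁ x → Enters D u Z₁ x) →
               ∀ Z₂ U₂ → (∀ {x} → mem A x → ¬ mem U₂ x → Enters (Z₁ ++ D) t Z₂ x) →
               PathIn {G = G} (A ∖ (U₁ ∪ (U₂ ∪ ⟪ Z₂ ++ Z₁ ++ D ⟫))) (2 *ℕ k) → Cycle (2 *ℕ n)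
        join complete Z₁ U₁ route₁ Z₂ U₂ route₂ (y , x , ps , p-ps , u-ps , |ps| , ps⊆)
          with route₁ (proj₁ (ps⊆ (end∈ p-ps))) (proj₂ (ps⊆ (end∈ p-ps)) ∘ inj₁)
             | route₂ (proj₁ (ps⊆ (here refl))) (proj₂ (ps⊆ (here refl)) ∘ inj₂ ∘ inj₁)
        ... | as , p-as , u-as , as⊆ , |as| , avoid₁ | bs , p-bs , u-bs , bs⊆ , |bs| , avoid₂ =
              close complete Z₁ Z₂ k split p-ps u-ps |ps| (λ q q′ → proj₂ (ps⊆ q) (inj₂ (inj₂ q′)))
                p-as u-as |as| as⊆ avoid₁ p-bs u-bs |bs| bs⊆ avoid₂
        choose-path : ∀ {u t D} → Completes u t D → length D ≤ diam c +ℕ core c →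
                      (F : Funnel D u) → Funnel (proj₁ F ++ D) t → Cycle (2 *ℕ n)
        choose-path {D = D} complete |D| (Z₁ , U₁ , |Z₁| , few₁ , route₁) (Z₂ , U₂ , |Z₂| , few₂ , route₂) =
          join complete Z₁ U₁ route₁ Z₂ U₂ route₂
            (avoiding-path expanding large (U₁ ∪ (U₂ ∪ ⟪ Z₂ ++ Z₁ ++ D ⟫))
               (card-∪₃ U₁ U₂ (Z₂ ++ Z₁ ++ D) few₁ few₂
                 (within (Z₂ ++ Z₁ ++ D) _ (++-bound Z₂ |Z₂| (++-bound Z₁ |Z₁| |D|)) (spread+core≤reserve c)))
               (2 *ℕ k) (ℕₚ.*-monoʳ-< 2 (subst (k <ℕ_) split (ℕₚ.m<n+m k links>0))))
        second-funnel : ∀ {u t D} → Completes u t D → length D ≤ diam c +ℕ core c → mem A t →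
                        Funnel D u → Cycle (2 *ℕ n)
        second-funnel {D = D} complete |D| At F@(Z₁ , _ , |Z₁| , _) =
          choose-path complete |D| F
            (funnel (Z₁ ++ D) At (within (Z₁ ++ D) (spread c +ℕ (diam c +ℕ core c)) (++-bound Z₁ |Z₁| |D|)
               (ℕₚ.≤-trans (ℕₚ.m≤n+m (spread c +ℕ (diam c +ℕ core c)) (spread c)) (spread+core≤reserve c))))
        choose-core : Flexible → Cycle (2 *ℕ n)
        choose-core (u , t , D , Au , At , |D| , complete) = second-funnel complete |D| At
          (funnel D Au (within D (diam c +ℕ core c) |D|
             (ℕₚ.≤-trans (ℕₚ.m≤n+m (diam c +ℕ core c) (spread c))
               (ℕₚ.≤-trans (ℕₚ.m≤n+m (spread c +ℕ (diam c +ℕ core c)) (spread c)) (spread+core≤reserve c)))))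

-- Stars and wheels in a colouring

lookup-injective : ∀ {X : Set} {l : List X} → Unique l → ∀ {i j} → lookup l i ≡ lookup l j → i ≡ j
lookup-injective {l = x ∷ l} u {zero}  {zero}  eq = refl
lookup-injective {l = x ∷ l} u {zero}  {suc j} eq = ⊥-elim (unique-head u (subst (_∈ l) (sym eq) (∈-lookup j)))
lookup-injective {l = x ∷ l} u {suc i} {zero}  eq = ⊥-elim (unique-head u (subst (_∈ l) eq (∈-lookup i)))
lookup-injective {l = x ∷ l} u {suc i} {suc j} eq = cong suc (lookup-injective (unique-tail u) eq)

module _ {N : ℕ} {G : SGraph N} where
  open SGraph G

  path-first : ∀ {a b vs} → Path G a b vs → ∀ j → toℕ j ≡ 0 → a ~ lookup vs j
  path-first (e ∷ p) zero _ = e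

  path-next : ∀ {a b vs} → Path G a b vs → ∀ i j → toℕ j ≡ suc (toℕ i) → lookup vs i ~ lookup vs j
  path-next (e ∷ p) zero    (suc j) eq = path-first p j (ℕₚ.suc-injective eq)
  path-next (e ∷ p) (suc i) (suc j) eq = path-next p i j (ℕₚ.suc-injective eq)

  path-last : ∀ {a b vs} → Path G a b vs → ∀ i → suc (toℕ i) ≡ length vs → lookup vs i ≡ b
  path-last (e ∷ [])     zero    _  = refl
  path-last (e ∷ e′ ∷ p) (suc i) eq = path-last (e′ ∷ p) i (ℕₚ.suc-injective eq)

module _ {N : ℕ} (col : Colouring N) where

  red : Fin N → DSet N
  red v = dset (λ w → w ≢ v × proj₁ col v w ≡ true)
               (λ w → ¬? (w Fₚ.≟ v) ×-dec (proj₁ col v w 𝔹ₚ.≟ true))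

  blue : SGraph N
  blue = record
    { _~_   = λ u v → v ≢ u × proj₁ col u v ≡ false
    ; _~?_  = λ u v → ¬? (v Fₚ.≟ u) ×-dec (proj₁ col u v 𝔹ₚ.≟ false)
    ; ~-sym = λ {u} {v} (≢ , eq) → ≢ ∘ sym , trans (proj₂ col v u) eq
    ; ~-irr = λ (≢ , _) → ≢ refl
    }

  star-copy : ∀ v l → Unique l → (∀ {w} → w ∈ l → mem (red v) w) → HasCopy col true (Star (length l))
  star-copy v l u l⊆ = f , injective , adjacent
    where
    f : Fin (suc (length l)) → Fin N
    f zero    = v
    f (suc i) = lookup l i
    injective : ∀ {i j} → f i ≡ f j → i ≡ j
    injective {zero}  {zero}  _  = refl
    injective {zero}  {suc j} eq = ⊥-elim (proj₁ (l⊆ (∈-lookup j)) (sym eq))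
    injective {suc i} {zero}  eq = ⊥-elim (proj₁ (l⊆ (∈-lookup i)) eq)
    injective {suc i} {suc j} eq = cong suc (lookup-injective u eq)
    adjacent : ∀ i j → StarAdj i j → proj₁ col (f i) (f j) ≡ true
    adjacent _ _ (centre-leaf i) = proj₂ (l⊆ (∈-lookup i))
    adjacent _ _ (leaf-centre i) = trans (proj₂ col _ v) (proj₂ (l⊆ (∈-lookup i)))

  wheel-copy : ∀ h {u vs} → Path blue u u vs → Unique vs → (∀ {v} → v ∈ vs → SGraph._~_ blue h v) →
               HasCopy col false (Wheel (length vs))
  wheel-copy h {u} {vs} p u-vs hub = f , injective , adjacent
    where
    f : Fin (suc (length vs)) → Fin N
    f zero    = h
    f (suc i) = lookup vs i
    injective : ∀ {i j} → f i ≡ f j → i ≡ j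
    injective {zero}  {zero}  _  = refl
    injective {zero}  {suc j} eq = ⊥-elim (proj₁ (hub (∈-lookup j)) (sym eq))
    injective {suc i} {zero}  eq = ⊥-elim (proj₁ (hub (∈-lookup i)) eq)
    injective {suc i} {suc j} eq = cong suc (lookup-injective u-vs eq)
    next : ∀ i j → Next (length vs) i j → proj₁ col (lookup vs i) (lookup vs j) ≡ false
    next i j (inj₁ eq)         = proj₂ (path-next p i j eq)
    -- The list ends in `u`, where the path starts, so the pair that wraps around is the first edge.
    next i j (inj₂ (eq , eq′)) =
      subst (λ w → proj₁ col w (lookup vs j) ≡ false) (sym (path-last p i eq)) (proj₂ (path-first p j eq′))
    adjacent : ∀ i j → WheelAdj i j → proj₁ col (f i) (f j) ≡ false
    adjacent _ _ (hub-rim i)      = proj₂ (hub (∈-lookup i))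
    adjacent _ _ (rim-hub i)      = trans (proj₂ col _ h) (proj₂ (hub (∈-lookup i)))
    adjacent _ _ (rim-next i j e) = next i j e
    adjacent _ _ (rim-prev i j e) = trans (proj₂ col _ (lookup vs j)) (next j i e)

-- Wheels from cuts and from expansion

module Induced {N : ℕ} (G : SGraph N) (A : DSet N) where
  open SGraph G

  induced : SGraph N
  induced = record
    { _~_   = λ u v → mem A u × mem A v × u ~ v
    ; _~?_  = λ u v → mem? A u ×-dec (mem? A v ×-dec (u ~? v))
    ; ~-sym = λ (a , b , e) → b , a , ~-sym e
    ; ~-irr = λ (_ , _ , e) → ~-irr e
    }

  path-induced : ∀ {a b vs} → Path induced a b vs → Path G a b vs
  path-induced []                = []
  path-induced ((_ , _ , e) ∷ p) = e ∷ path-induced p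

  path⊆ : ∀ {a b vs} → Path induced a b vs → ∀ {v} → v ∈ vs → mem A v
  path⊆ ((_ , Aw , _) ∷ p) (here refl) = Aw
  path⊆ (_ ∷ p)            (there q)   = path⊆ p q

module WheelFinder {N : ℕ} (G : SGraph N) (m n e c : ℕ) (N≡ : N ≡ 2 *ℕ m +ℕ n +ℕ e) (n<m : n <ℕ m) (0<n : 0 <ℕ n)
                   (0<e : 0 <ℕ e) (0<c : 0 <ℕ c) (N≤ : N ≤ c *ℕ e) (enough : threshold c ≤ e) where
  open SGraph G

  non : Fin N → DSet N
  non v = full ∖ nbr v

  total : 2 *ℕ m +ℕ n +ℕ e ≤ card {N} full
  total = ℕₚ.≤-reflexive (sym (trans card-full N≡))

  HubbedCycle : Set
  HubbedCycle = ∃[ h ] ∃[ u ] ∃[ vs ] Path G u u vs × Unique vs × length vs ≡ 2 *ℕ n × (∀ {v} → v ∈ vs → h ~ v)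

  module _ (sparse : ∀ v → card (non v) ≤ m) where

    -- A vertex of Y is a non-neighbour of every vertex of X, so the vertices of X have few
    -- non-neighbours outside Y, and any three of them have many common neighbours.
    cut-wheel : ∀ (X Y : DSet N) {x} → mem X x → (∀ {v w} → mem X v → mem Y w → ¬ (v ~ w)) →
                (∀ v → mem X v → ¬ mem Y v) → card X ≤ card Y → m +ℕ n ≤ card X +ℕ card Y → HubbedCycle
    cut-wheel X Y {x} Xx apart disjoint X≤Y large = choose
          (pick-list P [] n (subst (_≤ card P) (sym (ℕₚ.+-identityʳ n)) n≤P))
      where
      P : DSet N
      P = nbr x ∩ X
      far : ∀ {v} → mem X v → card Y +ℕ card (non v ∖ Y) ≤ m
      far {v} Xv = ℕₚ.≤-trans
        (card-disjoint (non v) Y (non v ∖ Y) (λ w Yw → refl , apart Xv Yw) (λ _ → proj₁) (λ _ p q → proj₂ q p))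
        (sparse v)
      -- The non-neighbours of `x` in `X` lie outside `Y`, so there are at most `m - card Y` of
      -- them, which leaves `card X + card Y - m ≥ n`.
      n≤P : n ≤ card P
      n≤P = arith m n (card X) (card Y) (card P) (card (non x ∖ Y)) large
        (card-cover X P (non x ∖ Y) split) (far Xx)
        where
        split : ∀ v → mem X v → (x ~ v × mem X v) ⊎ ((v ≡ v × ¬ (x ~ v)) × ¬ mem Y v)
        split v Xv with x ~? v
        ... | yes a = inj₁ (a , Xv)
        ... | no ¬a = inj₂ ((refl , ¬a) , disjoint v Xv)
        arith : ∀ m n x y p d → m +ℕ n ≤ x +ℕ y → x ≤ p +ℕ d → y +ℕ d ≤ m → n ≤ p
        arith m n x y p d h₁ h₂ h₃ = linear 0 (h₁ ⊕ h₂ ⊕ h₃) (solve (m ◂ n ◂ x ◂ y ◂ p ◂ d ◂ ∎ₗ))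
      -- Outside `Y` there are at least `2m + n + e - card Y` vertices, and each of `x`, `a`, `b`
      -- misses at most `m - card Y` of them. At least `2 card Y + n + e - m` remain, and
      -- `2 card Y ≥ card X + card Y ≥ m + n`.
      rich : ∀ {a b} → mem X a → mem X b → 2 *ℕ n ≤ card (nbr x ∩ (nbr a ∩ nbr b))
      rich {a} {b} Xa Xb = arith m n e (card X) (card Y) (card (non x ∖ Y)) (card (non a ∖ Y)) (card (non b ∖ Y))
        (card R₀) (card R₁) (card R₂) (card R₃) _
        (ℕₚ.≤-trans total (card-cover full Y R₀ (λ v _ → in-Y v)))
        (peel R₀ x (λ v → proj₂)) (peel R₁ a (λ v → proj₂ ∘ proj₁)) (peel R₂ b (λ v → proj₂ ∘ proj₁ ∘ proj₁))
        (card-mono R₃ (nbr x ∩ (nbr a ∩ nbr b)) (λ v (((_ , p) , q) , r) → p , q , r))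
        (far Xx) (far Xa) (far Xb) X≤Y large
        where
        R₀ R₁ R₂ R₃ : DSet N
        R₀ = full ∖ Y
        R₁ = R₀ ∩ nbr x
        R₂ = R₁ ∩ nbr a
        R₃ = R₂ ∩ nbr b
        in-Y : ∀ v → mem Y v ⊎ mem R₀ v
        in-Y v with mem? Y v
        ... | yes y = inj₁ y
        ... | no ¬y = inj₂ (refl , ¬y)
        peel : ∀ R v → (∀ w → mem R w → ¬ mem Y w) → card R ≤ card (non v ∖ Y) +ℕ card (R ∩ nbr v)
        peel R v avoid = card-cover R (non v ∖ Y) (R ∩ nbr v) split
          where
          split : ∀ w → mem R w → ((w ≡ w × ¬ (v ~ w)) × ¬ mem Y w) ⊎ (mem R w × v ~ w)
          split w Rw with v ~? w
          ... | yes a = inj₂ (Rw , a)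
          ... | no ¬a = inj₁ ((refl , ¬a) , avoid w Rw)
        arith : ∀ m n e x y d₀ d₁ d₂ r₀ r₁ r₂ r₃ t → 2 *ℕ m +ℕ n +ℕ e ≤ y +ℕ r₀ → r₀ ≤ d₀ +ℕ r₁ → r₁ ≤ d₁ +ℕ r₂ →
                r₂ ≤ d₂ +ℕ r₃ → r₃ ≤ t → y +ℕ d₀ ≤ m → y +ℕ d₁ ≤ m → y +ℕ d₂ ≤ m → x ≤ y → m +ℕ n ≤ x +ℕ y →
                2 *ℕ n ≤ t
        arith m n e x y d₀ d₁ d₂ r₀ r₁ r₂ r₃ t h₁ h₂ h₃ h₄ h₅ h₆ h₇ h₈ h₉ h₁₀ =
          linear e (h₁ ⊕ h₂ ⊕ h₃ ⊕ h₄ ⊕ h₅ ⊕ h₆ ⊕ h₇ ⊕ h₈ ⊕ h₉ ⊕ h₁₀)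
            (solve (m ◂ n ◂ e ◂ x ◂ y ◂ d₀ ◂ d₁ ◂ d₂ ◂ r₀ ◂ r₁ ◂ r₂ ◂ r₃ ◂ t ◂ ∎ₗ))
      choose : (∃[ l ] Unique l × length l ≡ n × (∀ {v} → v ∈ l → mem P v × v ∉ [])) → HubbedCycle
      choose ([] , _ , len , _) = ⊥-elim (ℕₚ.<-irrefl len 0<n)
      choose (h ∷ hs , u , len , l⊆) =
        let vs , p , u-vs , |vs| , sub = alternating-cycle {G = G} (nbr x) h hs u
              (λ {a} {b} p q → subst (λ k → 2 *ℕ k ≤ card (nbr x ∩ (nbr a ∩ nbr b))) (sym len)
                    (rich (proj₂ (proj₁ (l⊆ p))) (proj₂ (proj₁ (l⊆ q)))))
        in x , h , vs , p , u-vs , trans |vs| (cong (2 *ℕ_) len) ,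
           λ v∈ → [ (λ q → proj₁ (proj₁ (l⊆ q))) , id ]′ (sub v∈)

    module Neighbourhood (v₀ : Fin N) where
      A : DSet N
      A = nbr v₀

      open Induced G A

      large : m +ℕ n +ℕ e ≤ card A
      large = arith m n e (card A) (card (non v₀))
        (ℕₚ.≤-trans total (card-cover full A (non v₀) split)) (sparse v₀)
        where
        split : ∀ v → v ≡ v → v₀ ~ v ⊎ (v ≡ v × ¬ (v₀ ~ v))
        split v _ with v₀ ~? v
        ... | yes a = inj₁ a
        ... | no ¬a = inj₂ (refl , ¬a)
        arith : ∀ m n e a d → 2 *ℕ m +ℕ n +ℕ e ≤ a +ℕ d → d ≤ m → m +ℕ n +ℕ e ≤ a
        arith m n e a d h₁ h₂ = linear 0 (h₁ ⊕ h₂) (solve (m ◂ n ◂ e ◂ a ◂ d ◂ ∎ₗ))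

      degree : ∀ {v} → mem A v → n +ℕ e ≤ card (SGraph.nbr induced v)
      degree {v} Av = arith m n e (card A) (card (SGraph.nbr induced v)) (card (non v)) large
        (card-cover A (SGraph.nbr induced v) (non v) split) (sparse v)
        where
        split : ∀ w → mem A w → (mem A v × mem A w × v ~ w) ⊎ (w ≡ w × ¬ (v ~ w))
        split w Aw with v ~? w
        ... | yes a = inj₁ (Av , Aw , a)
        ... | no ¬a = inj₂ (refl , ¬a)
        arith : ∀ m n e a b d → m +ℕ n +ℕ e ≤ a → a ≤ b +ℕ d → d ≤ m → n +ℕ e ≤ b
        arith m n e a b d h₁ h₂ h₃ = linear 0 (h₁ ⊕ h₂ ⊕ h₃) (solve (m ◂ n ◂ e ◂ a ◂ b ◂ d ◂ ∎ₗ))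

      open Assembly induced A proj₁ e c 0<e 0<c N≤ enough n degree using (Cycle; short-cycle; long-cycle)

      around : Cycle (2 *ℕ n) → HubbedCycle
      around (u , vs , p , u-vs , |vs|) = v₀ , u , vs , path-induced p , u-vs , |vs| , path⊆ p

      expanding-wheel : Expanding induced A e → HubbedCycle
      expanding-wheel expanding = cases (n ≤? links c)
        where
        cases : Dec (n ≤ links c) → HubbedCycle
        cases (yes n≤) = around (short-cycle (ℕₚ.≤-trans (ℕₚ.m≤n+m e (m +ℕ n)) large) 0<n n≤)
        cases (no n≰) =
          let k , eq = ℕₚ.m≤n⇒∃[o]m+o≡n (ℕₚ.<⇒≤ (ℕₚ.≰⇒> n≰))
              _ , Ao , _ = pick A [] (ℕₚ.<-≤-trans 0<e (ℕₚ.≤-trans (ℕₚ.m≤n+m e (m +ℕ n)) large))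
          in around (long-cycle expanding Ao (arith m n e (card A) n<m large) k eq)
          where
          arith : ∀ m n e a → suc n ≤ m → m +ℕ n +ℕ e ≤ a → 2 *ℕ n +ℕ e ≤ a
          arith m n e a h₁ h₂ = linear 1 (h₁ ⊕ h₂) (solve (m ◂ n ◂ e ◂ a ◂ ∎ₗ))

      -- `A` has at least `m + n + e` vertices, at most `e` of them on the boundary, so the two
      -- sides have `m + n` together; the smaller side supplies the hub.
      cut-case : ∀ X → Separated induced A X → card (boundary induced X) ≤ e → HubbedCycle
      cut-case X (X⊆A , (x , Xx) , y , Ay , ¬Xy , ¬∂y) small = cases (ℕₚ.≤-total (card X) (card Y))
        where
        ∂ Y : DSet N
        ∂ = boundary induced X
        Y = A ∖ (X ∪ ∂)
        apart : ∀ {v w} → mem X v → mem Y w → ¬ (v ~ w)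
        apart {v} {w} Xv (Aw , w∉) a = w∉ (inj₂ (w∉ ∘ inj₁ , v , Xv , X⊆A v Xv , Aw , a))
        split : ∀ v → mem A v → mem X v ⊎ mem (A ∖ X) v
        split v Av with mem? X v
        ... | yes p = inj₁ p
        ... | no ¬p = inj₂ (Av , ¬p)
        split′ : ∀ v → mem (A ∖ X) v → mem ∂ v ⊎ mem Y v
        split′ v (Av , ¬Xv) with mem? ∂ v
        ... | yes p = inj₁ p
        ... | no ¬p = inj₂ (Av , [ ¬Xv , ¬p ]′)
        sides : m +ℕ n ≤ card X +ℕ card Y
        sides = arith m n e (card A) (card X) (card (A ∖ X)) (card ∂) (card Y) large
          (card-cover A X (A ∖ X) split) (card-cover (A ∖ X) ∂ Y split′) small
          where
          arith : ∀ m n e a x r b y → m +ℕ n +ℕ e ≤ a → a ≤ x +ℕ r → r ≤ b +ℕ y → b ≤ e → m +ℕ n ≤ x +ℕ y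
          arith m n e a x r b y h₁ h₂ h₃ h₄ =
            linear 0 (h₁ ⊕ h₂ ⊕ h₃ ⊕ h₄) (solve (m ◂ n ◂ e ◂ a ◂ x ◂ r ◂ b ◂ y ◂ ∎ₗ))
        cases : card X ≤ card Y ⊎ card Y ≤ card X → HubbedCycle
        cases (inj₁ X≤Y) = cut-wheel X Y Xx apart (λ v Xv (_ , v∉) → v∉ (inj₁ Xv)) X≤Y sides
        cases (inj₂ Y≤X) = cut-wheel Y X {y} (Ay , [ ¬Xy , ¬∂y ]′) (λ Yv Xw a → apart Xw Yv (~-sym a))
          (λ v (_ , v∉) Xv → v∉ (inj₁ Xv)) Y≤X (subst (m +ℕ n ≤_) (ℕₚ.+-comm (card X) (card Y)) sides)

      wheel : HubbedCycle
      wheel = [ expanding-wheel , (λ (X , separated , small) → cut-case X separated small) ]′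
              (expanding-or-cut induced A e)

-- The arrow relation and the rational bound

arrows : ∀ m n e c → n <ℕ m → 0 <ℕ n → 0 <ℕ e → 0 <ℕ c → 2 *ℕ m +ℕ n +ℕ e ≤ c *ℕ e → threshold c ≤ e →
         Arrows (2 *ℕ m +ℕ n +ℕ e) (Star m) (Wheel (2 *ℕ n))
arrows m n e c n<m 0<n 0<e 0<c N≤ enough col = cases (Fₚ.any? (λ v → m ≤? card (red col v)))
  where
  open WheelFinder (blue col) m n e c refl n<m 0<n 0<e 0<c N≤ enough
  v₀ : Fin (2 *ℕ m +ℕ n +ℕ e)
  v₀ = fromℕ< {0} (ℕₚ.<-≤-trans 0<e (ℕₚ.m≤n+m e (2 *ℕ m +ℕ n)))
  -- `v` is its own non-neighbour; the strict bound on red degrees leaves room for it.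
  sparse : ¬ (∃[ v ] m ≤ card (red col v)) → ∀ v → card (non v) ≤ m
  sparse ¬star v = ℕₚ.≤-trans (card-cover (non v) ⟪ [ v ] ⟫ (red col v) split)
    (subst (λ k → k +ℕ card (red col v) ≤ m) (sym (card-singleton v)) (ℕₚ.≰⇒> (λ le → ¬star (v , le))))
    where
    split : ∀ w → mem (non v) w → w ∈ [ v ] ⊎ mem (red col v) w
    split w (_ , ¬blue) with w Fₚ.≟ v
    ... | yes eq = inj₁ (here eq)
    ... | no ≢v  = inj₂ (≢v , 𝔹ₚ.¬-not (λ eq → ¬blue (≢v , eq)))
  star : ∀ v → (∃[ l ] Unique l × length l ≡ m × (∀ {w} → w ∈ l → mem (red col v) w × w ∉ [])) →
        HasCopy col true (Star m)
  star v (l , u , |l| , l⊆) = subst (λ k → HasCopy col true (Star k)) |l| (star-copy col v l u (proj₁ ∘ l⊆))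
  cases : Dec (∃[ v ] m ≤ card (red col v)) → HasCopy col true (Star m) ⊎ HasCopy col false (Wheel (2 *ℕ n))
  cases (yes (v , le)) = inj₁ (star v (pick-list (red col v) [] m
        (subst (_≤ card (red col v)) (sym (ℕₚ.+-identityʳ m)) le)))
  cases (no ¬star) with Neighbourhood.wheel (sparse ¬star) v₀
  ... | h , u , vs , p , u-vs , |vs| , hub =
        inj₂ (subst (λ k → HasCopy col false (Wheel k)) |vs| (wheel-copy col h p u-vs hub))

-- With `ε = (a + 1) / d` the claim reduces to `e ≤ ε m`, which follows from `e d ≤ m` as the
-- numerator is at least 1. Between unnormalised fractions it becomes a polynomial inequality in
-- natural numbers.
rational-bound : ∀ a d-1 .(cop : Coprime (suc a) (suc d-1)) m n e → e *ℕ suc d-1 ≤ m →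
      let ε = ℚ.mkℚ ℤ.+[1+ a ] d-1 cop in
                 + (2 *ℕ m +ℕ n +ℕ e) / 1 ℚ.≤ (+ 2 / 1 + ε) * (+ m / 1) + (+ n / 1)
rational-bound a d-1 cop m n e le = ℚₚ.toℚᵘ-cancel-≤ (begin
  ℚ.toℚᵘ (+ (2 *ℕ m +ℕ n +ℕ e) / 1)                     ≃⟨ integer (2 *ℕ m +ℕ n +ℕ e) ⟩
  whole (2 *ℕ m +ℕ n +ℕ e)                              ≤⟨ ℚᵘ.*≤* cross ⟩
  (whole 2 ℚᵘ.+ ℚ.toℚᵘ ε) ℚᵘ.* whole m ℚᵘ.+ whole n     ≃⟨ expand ⟨
  ℚ.toℚᵘ ((+ 2 / 1 + ε) * (+ m / 1) + (+ n / 1))        ∎)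
  where
  open ℚᵘₚ.≤-Reasoning
  ε : ℚ
  ε = ℚ.mkℚ ℤ.+[1+ a ] d-1 cop
  whole : ℕ → ℚᵘ.ℚᵘ
  whole k = ℚᵘ.mkℚᵘ (+ k) 0
  integer : ∀ k → ℚ.toℚᵘ (+ k / 1) ℚᵘ.≃ whole k
  integer k = ℚₚ.toℚᵘ-fromℚᵘ (whole k)
  expand : ℚ.toℚᵘ ((+ 2 / 1 + ε) * (+ m / 1) + (+ n / 1)) ℚᵘ.≃
           (whole 2 ℚᵘ.+ ℚ.toℚᵘ ε) ℚᵘ.* whole m ℚᵘ.+ whole n
  expand = ℚᵘₚ.≃-trans (ℚₚ.toℚᵘ-homo-+ ((+ 2 / 1 + ε) * (+ m / 1)) (+ n / 1))
    (ℚᵘₚ.+-cong (ℚᵘₚ.≃-trans (ℚₚ.toℚᵘ-homo-* (+ 2 / 1 + ε) (+ m / 1))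
                  (ℚᵘₚ.*-cong (ℚᵘₚ.≃-trans (ℚₚ.toℚᵘ-homo-+ (+ 2 / 1) ε)
                                (ℚᵘₚ.+-cong (integer 2) (ℚᵘₚ.≃-refl {ℚ.toℚᵘ ε})))
                              (integer m)))
                (integer n))
  d X dd : ℕ
  d = suc d-1
  X = 2 *ℕ d +ℕ suc a *ℕ 1
  dd = ℚᵘ.↧ₙ ((whole 2 ℚᵘ.+ ℚ.toℚᵘ ε) ℚᵘ.* whole m)
  dd≡d : dd ≡ d
  dd≡d = cong suc (trans (ℕₚ.*-identityʳ (d-1 +ℕ 0)) (ℕₚ.+-identityʳ d-1))
  arith : ∀ a d m n e → e *ℕ d ≤ m → (2 *ℕ m +ℕ n +ℕ e) *ℕ (d *ℕ 1) ≤
        ((2 *ℕ d +ℕ suc a *ℕ 1) *ℕ m *ℕ 1 +ℕ n *ℕ d) *ℕ 1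
  arith a d m n e h = linear (a *ℕ m) h (solve (a ◂ d ◂ m ◂ n ◂ e ◂ ∎ₗ))
  cross : + (2 *ℕ m +ℕ n +ℕ e) ℤ.* ℚᵘ.↧ ((whole 2 ℚᵘ.+ ℚ.toℚᵘ ε) ℚᵘ.* whole m ℚᵘ.+ whole n) ℤ.≤
          ℚᵘ.↥ ((whole 2 ℚᵘ.+ ℚ.toℚᵘ ε) ℚᵘ.* whole m ℚᵘ.+ whole n) ℤ.* + 1
  cross = subst₂ ℤ._≤_ (ℤₚ.pos-* (2 *ℕ m +ℕ n +ℕ e) (dd *ℕ 1))
    (trans (ℤₚ.pos-* (X *ℕ m *ℕ 1 +ℕ n *ℕ dd) 1) (cong (ℤ._* + 1) (cong₂ ℤ._+_
      (trans (ℤₚ.pos-* (X *ℕ m) 1) (cong (ℤ._* + 1) (ℤₚ.pos-* X m))) (ℤₚ.pos-* n dd))))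
    (ℤ.+≤+ (subst (λ k → (2 *ℕ m +ℕ n +ℕ e) *ℕ (k *ℕ 1) ≤ (X *ℕ m *ℕ 1 +ℕ n *ℕ k) *ℕ 1) (sym dd≡d)
          (arith a d m n e le)))

theorem1p3 : (ε : ℚ) → 0ℚ < ε →
    Σ ℕ λ m₀ → (n m : ℕ) → m ≥ m₀ → m > n → n ≥ 2 →
    Σ ℕ λ N → (Data.Rational._≤_ (+ N / 1) (((+ 2 / 1) + ε) * (+ m / 1) + (+ n / 1)))
    × Arrows N (Star m) (Wheel (2 Data.Nat.* n))
theorem1p3 (ℚ.mkℚ (+ zero) d-1 cop) (ℚ.*<* (ℤ.+<+ ()))
theorem1p3 (ℚ.mkℚ ℤ.-[1+ a ] d-1 cop) (ℚ.*<* ())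
-- This `m₀` makes the quotient `e` of `m` by `d` exceed the threshold.
theorem1p3 (ℚ.mkℚ ℤ.+[1+ a ] d-1 cop) _ = suc (threshold c) *ℕ d , λ n m m≥ n<m n≥2 →
  let e  = m /ℕ d
      e≥ : suc (threshold c) ≤ e
      e≥ = subst (_≤ e) (DM.m*n/n≡m (suc (threshold c)) d) (DM./-monoˡ-≤ d m≥)
  in 2 *ℕ m +ℕ n +ℕ e , rational-bound a d-1 cop m n e (DM.m/n*n≤m m d) ,
     arrows m n e c n<m (ℕₚ.<⇒≤ n≥2) (ℕₚ.≤-trans (s≤s z≤n) e≥) z<s
       (arith d (m ℕ.% d) m n e (DM.m≡m%n+[m/n]*n m d) (DM.m%n<n m d) n<m (ℕₚ.≤-trans (s≤s z≤n) e≥))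
       (ℕₚ.<⇒≤ e≥)
  where
  d c : ℕ
  d = suc d-1
  -- `2m + n + e` is below `3m + e`, and `m < (e + 1) d ≤ 2 e d` because `e ≥ 1`; hence the factor
  -- `6d + 1`.
  c = suc (6 *ℕ d)
  arith : ∀ d r m n e → m ≡ r +ℕ e *ℕ d → r <ℕ d → n <ℕ m → 1 ≤ e → 2 *ℕ m +ℕ n +ℕ e ≤ suc (6 *ℕ d) *ℕ e
  arith d r m n e h₁ h₂ h₃ h₄ =
    linear 4 (3 ⊛ ℕₚ.≤-reflexive h₁ ⊕ 3 ⊛ h₂ ⊕ h₃ ⊕ (3 *ℕ d) ⊛ h₄) (solve (d ◂ r ◂ m ◂ n ◂ e ◂ ∎ₗ))
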